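{- Let $p_1<p_2<p_3$ be odd primes with $p_2\equiv 1 \pmod{p_1}$ and $p_3\equiv 1\pmod{p_1p_2}$. Let $q_2=\lfloor p_2/p_1\rfloor=(p_2-1)/p_1$ and $q_3=\lfloor p_3/(p_1p_2)\rfloor=(p_3-1)/(p_1p_2)$. Let $$I=\{0,\ldots,p_1-2\}\times\{0,\ldots,q_2-1\}\times\{0,\ldots,p_1-1\}\times\{0,\ldots,q_3-1\},$$ $$\rho=\big((p_2-1)(p_3-1),\ p_1(p_3-1),\ p_3-1,\ p_1p_2\big),$$ and for $i=(i_1,i_2,i_3,i_4)\in I$ write $i\cdot\rho=i_1\rho_1+i_2\rho_2+i_3\rho_3+i_4\rho_4$. For $i\in I$ define $$g_i=\begin{cases} +x^{i_1p_2+i_2p_1+1}\sum_{k=0}^{p_1-2-i_1}x^k & \text{if } i_3\le i_1,\\ -x^{i_1(p_2-1)+(i_2+1)p_1}\sum_{k=0}^{i_1}x^k & \text{if } i_3>i_1,\end{cases}\qquad f_i=1+g_i-x^{(i_1+1)p_2}-x^{p_2}g_i .$$ Then: (C1) $\displaystyle \Phi_{p_1p_2p_3}=\sum_{i\in I} f_i\,x^{i\cdot\rho}+x^{\varphi(p_1p_2p_3)}$. (C2) If each $f_i$ is expanded as the list of monomials $1$, the monomials $\pm x^{e}$ of $g_i$ (one for each $k$ in its sum), $-x^{(i_1+1)p_2}$, and the monomials of $-x^{p_2}g_i$ (one for each $k$), and the summation over $i\in I$ is carried out as iterated sums $\sum_{i_1}\sum_{i_2}\sum_{i_3}\sum_{i_4}$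 (i.e. $i$ in lexicographic order), followed by the final term $x^{\varphi(p_1p_2p_3)}$, then all monomials in the resulting expression have pairwise distinct exponents (there is no cancellation or accumulation of terms) and their exponents appear in strictly ascending order.
   Context: $\Phi_n$ denotes the $n$-th cyclotomic polynomial (the monic polynomial in $\mathbb{Z}[x]$ whose roots are the primitive $n$-th roots of unity), and $\varphi$ is Euler's totient function, so $\varphi(p_1p_2p_3)=(p_1-1)(p_2-1)(p_3-1)=\deg\Phi_{p_1p_2p_3}$. -}

module Defs where

open import Data.Nat as ℕ using (ℕ; zero; suc; _∸_; _≤?_; _+_; _*_)
open import Data.Nat.DivMod using (_/_)
open import Data.Nat.Divisibility using (_∣?_)
open import Data.Nat.Coprimality using (coprime?)
open import Data.Integer as ℤ using (ℤ; +_; -[1+_])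
open import Data.List using (List; []; _∷_; _++_; [_]; map; reverse; dropWhile; filter; length; upTo; replicate; concatMap; foldr)
open import Data.Product using (_×_; _,_; proj₁; proj₂)
open import Relation.Nullary using (yes; no)

-- Polynomials over ℤ as little-endian coefficient lists
-- (entry at position k = coefficient of x^k).

Poly : Set
Poly = List ℤ

coeff : Poly → ℕ → ℤ
coeff []       _       = + 0
coeff (a ∷ p)  zero    = a
coeff (a ∷ p)  (suc k) = coeff p k

infixl 6 _+P_
infixl 7 _*P_

_+P_ : Poly → Poly → Poly
[]      +P q       = q
p       +P []      = p
(a ∷ p) +P (b ∷ q) = (a ℤ.+ b) ∷ (p +P q)

_*P_ : Poly → Poly → Poly
[]      *P q = []
(a ∷ p) *P q = map (a ℤ.*_) q +P (+ 0 ∷ (p *P q))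

xpow : ℕ → Poly
xpow n = replicate n (+ 0) ++ [ + 1 ]

xpow-1 : ℕ → Poly
xpow-1 n = xpow n +P [ -[1+ 0 ] ]

normalize : Poly → Poly
normalize p = reverse (dropWhile (ℤ._≟ + 0) (reverse p))

-- Quotient of p by a monic polynomial d (ordinary long division;
-- remainder discarded).  Works on big-endian lists internally.
private
  subL : List ℤ → List ℤ → List ℤ
  subL xs       []       = xs
  subL []       (y ∷ ys) = map ℤ.-_ (y ∷ ys)
  subL (x ∷ xs) (y ∷ ys) = (x ℤ.- y) ∷ subL xs ys

  longDiv : ℕ → List ℤ → List ℤ → List ℤ
  longDiv zero    ds r       = []
  longDiv (suc k) ds []      = []
  longDiv (suc k) ds (c ∷ r) = c ∷ longDiv k ds (subL r (map (c ℤ.*_) ds))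

divMonic : Poly → Poly → Poly
divMonic p d with reverse (normalize d)
... | []      = []
... | _ ∷ ds  = let p′ = reverse (normalize p) in
                reverse (longDiv (suc (length p′) ∸ suc (length ds)) ds p′)

prodP : List Poly → Poly
prodP = foldr _*P_ [ + 1 ]

properDivisors : ℕ → List ℕ
properDivisors n = filter (_∣? n) (map suc (upTo (n ∸ 1)))

-- Cyclotomic polynomials, defined by the standard recursion
--   Φ_n = (x^n - 1) / ∏_{d ∣ n, d < n} Φ_d     (n ≥ 1),
-- i.e. from  x^n - 1 = ∏_{d ∣ n} Φ_d .  The first argument of cycloF
-- is fuel; cycloF n n has enough fuel (every recursive call is on a
-- proper divisor d < n).  Φ_0 is set to 1 (irrelevant here).

cycloF : ℕ → ℕ → Poly
cycloF zero    n = [ + 1 ]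
cycloF (suc f) n = divMonic (xpow-1 n) (prodP (map (cycloF f) (properDivisors n)))

Φ : ℕ → Poly
Φ n = cycloF n n

φ : ℕ → ℕ
φ n = length (filter (λ k → coprime? k n) (map suc (upTo n)))

-- Formal sums of signed monomials: a term (c , e) stands for c·x^e.

Term : Set
Term = ℤ × ℕ

coeffT : List Term → ℕ → ℤ
coeffT []             k = + 0
coeffT ((c , e) ∷ ts) k with e ℕ.≟ k
... | yes _ = c ℤ.+ coeffT ts k
... | no  _ = coeffT ts k

exponents : List Term → List ℕ
exponents = map proj₂

-- floor division (m / 0 := 0; only used with nonzero divisors)
fdiv : ℕ → ℕ → ℕ
fdiv m zero    = 0
fdiv m (suc n) = m / suc n

module Construction (p₁ p₂ p₃ : ℕ) where


  q₂ : ℕ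
  q₂ = fdiv p₂ p₁

  q₃ : ℕ
  q₃ = fdiv p₃ (p₁ * p₂)

  dotρ : ℕ → ℕ → ℕ → ℕ → ℕ
  dotρ i₁ i₂ i₃ i₄ =
    i₁ * ((p₂ ∸ 1) * (p₃ ∸ 1)) + i₂ * (p₁ * (p₃ ∸ 1)) + i₃ * (p₃ ∸ 1) + i₄ * (p₁ * p₂)

  gTerms : ℕ → ℕ → ℕ → List Term
  gTerms i₁ i₂ i₃ with i₃ ≤? i₁
  ... | yes _ = map (λ k → (+ 1 , i₁ * p₂ + i₂ * p₁ + 1 + k)) (upTo (p₁ ∸ 1 ∸ i₁))
  ... | no  _ = map (λ k → (-[1+ 0 ] , i₁ * (p₂ ∸ 1) + (i₂ + 1) * p₁ + k)) (upTo (i₁ + 1))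

  fTerms : ℕ → ℕ → ℕ → List Term
  fTerms i₁ i₂ i₃ =
    (+ 1 , 0)
    ∷ gTerms i₁ i₂ i₃
    ++ (-[1+ 0 ] , (i₁ + 1) * p₂)
    ∷ map (λ t → (ℤ.- proj₁ t , p₂ + proj₂ t)) (gTerms i₁ i₂ i₃)

  shiftedTerms : ℕ → ℕ → ℕ → ℕ → List Term
  shiftedTerms i₁ i₂ i₃ i₄ =
    map (λ t → (proj₁ t , proj₂ t + dotρ i₁ i₂ i₃ i₄)) (fTerms i₁ i₂ i₃)

  allTerms : List Term
  allTerms =
    concatMap (λ i₁ →
      concatMap (λ i₂ →
        concatMap (λ i₃ →
          concatMap (λ i₄ → shiftedTerms i₁ i₂ i₃ i₄)
            (upTo q₃))
          (upTo p₁))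
        (upTo q₂))
      (upTo (p₁ ∸ 1))
    ++ [ (+ 1 , φ (p₁ * p₂ * p₃)) ]

{-# OPTIONS --safe #-}
module Submission where

-- Multiply the sum T of the terms by (x - 1)(x^{p₁p₂} - 1) and write y = x^{p₃-1}, t = x y = x^{p₃}.
-- The i₄-sum is geometric with value (y - 1)/(x^{p₁p₂} - 1), and (x - 1) fᵢ is 1 - x^{p₂} times a
-- difference of two monomials, plus a term depending on i₁ only.  Since i₁(p₂-1) + i₂p₁ + i₃
-- enumerates the exponents of y below (p₁-1)(p₂-1), summation by parts in y leaves precisely
-- (x^{p₁} - 1)(x^{p₂} - 1) Φ_{p₁p₂}(t), with Φ_{p₁p₂} in the explicit form available
-- for p₂ ≡ 1 (mod p₁).  Together with Φ_{p₁p₂}(t) (t^{p₁} - 1)(t^{p₂} - 1) = (t^{p₁p₂} - 1)(t - 1)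
-- and cancellation of series with constant term 1, T times the product of the Φ_d over the proper
-- divisors d of p₁p₂p₃ is x^{p₁p₂p₃} - 1, so the exact long division defining Φ_{p₁p₂p₃} returns T.
-- The exponents ascend because each fᵢ has degree below p₁p₂ and the four components of ρ tile
-- the interval [0, (p₁-1)(p₂-1)(p₃-1)).

open import Algebra.Bundles using (CommutativeRing)
import Algebra.Properties.CommutativeSemiring.Exp
import Algebra.Solver.Ring
open import Algebra.Solver.Ring.AlmostCommutativeRing
  using (fromCommutativeRing; _-Raw-AlmostCommutative⟶_)
open import Data.Integer as ℤ using (ℤ; -[1+_]; 0ℤ; 1ℤ; -1ℤ)
import Data.Integer.Properties as ℤ
import Data.Integer.Solver as ℤSolver
import Data.Maybe as Maybe
open import Data.Nat as ℕ using (ℕ; zero; suc; _≤_; _<_; z≤n; s≤s; _∸_)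
import Data.Nat.Properties as ℕ
import Data.Nat.Solver as ℕSolver
open import Function using (_∘_; flip; mk⇔)
open import Level using (0ℓ)
open import Relation.Binary.PropositionalEquality as ≡ using (_≡_)
open import Relation.Nullary.Decidable using (dec⇒maybe)
import Relation.Binary.Reasoning.Setoid

-- The identity behind the factor `(x - 1)(x^{p₁p₂} - 1)` is `T · Φ_{p₁p₂}(x) = Φ_{p₁p₂}(x^{p₃})`.
-- Writing `Φ_{p₁p₂}(x)` as `(x^{p₁p₂} - 1)(x - 1) / ((x^{p₁} - 1)(x^{p₂} - 1))` and clearing
-- denominators gives exactly the equation proved for `T`. Summation by parts fits because, along
-- the enumeration of the exponents of `y`, the value of `(x - 1) f` jumps only at the exponents
-- listed in the explicit form of `Φ_{p₁p₂}`. The algebra takes place in formal power series: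
-- coefficient lists are not unique because of trailing zeros, while series form a commutative ring
-- in which the ring solver applies and a factor can be cancelled without degree arguments. The
-- identities are stated for arbitrary ring elements, so that one polynomial `Φ₂` can be evaluated
-- both at `x` and at `x^{p₃}`. Lists return only for the long division, where monicity pins down
-- the normalized list. The degree bound that makes `T` monic comes from the ascending order of its
-- exponents.

module RingIdentities (R : CommutativeRing 0ℓ 0ℓ)
  (hom : ℤ.+-*-rawRing -Raw-AlmostCommutative⟶ fromCommutativeRing R) where

  open CommutativeRing R
  open _-Raw-AlmostCommutative⟶_ hom using (⟦_⟧; 0-homo)
  open Algebra.Properties.CommutativeSemiring.Exp commutativeSemiring public
  open Relation.Binary.Reasoning.Setoid setoid
  module Solver = Algebra.Solver.Ring ℤ.+-*-rawRing (fromCommutativeRing R) hom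
    (λ i j → Maybe.map (λ eq → reflexive (≡.cong ⟦_⟧ eq)) (dec⇒maybe (i ℤ.≟ j)))
  open Solver using (Polynomial; solve; _:=_; con; _:^_; _:+_; _:*_; _:-_; :-_)

  -- con 1ℤ would denote ⟦ 1ℤ ⟧, which is only propositionally 1#.
  :1 : ∀ {n} → Polynomial n
  :1 = con 0ℤ :^ 0

  -- Finite sums and geometric series in a commutative ring

  Σ : ℕ → (ℕ → Carrier) → Carrier
  Σ zero    f = 0#
  Σ (suc n) f = f 0 + Σ n (f ∘ suc)

  Σ-cong : ∀ n {f g} → (∀ i → i < n → f i ≈ g i) → Σ n f ≈ Σ n g
  Σ-cong zero    e = refl
  Σ-cong (suc n) e = +-cong (e 0 (s≤s z≤n)) (Σ-cong n (λ i i<n → e (suc i) (s≤s i<n)))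

  Σ-scaleˡ : ∀ n c f → c * Σ n f ≈ Σ n (λ i → c * f i)
  Σ-scaleˡ zero    c f = zeroʳ c
  Σ-scaleˡ (suc n) c f = trans (distribˡ c _ _) (+-congˡ (Σ-scaleˡ n c (f ∘ suc)))

  Σ-+ : ∀ n f g → Σ n f + Σ n g ≈ Σ n (λ i → f i + g i)
  Σ-+ zero    f g = +-identityˡ 0#
  Σ-+ (suc n) f g = trans
    (solve 4 (λ a b c d → a :+ b :+ (c :+ d) := a :+ c :+ (b :+ d)) refl _ _ _ _)
    (+-congˡ (Σ-+ n (f ∘ suc) (g ∘ suc)))

  Σ-split : ∀ m n f → Σ (m ℕ.+ n) f ≈ Σ m f + Σ n (f ∘ (m ℕ.+_))
  Σ-split zero    n f = sym (+-identityˡ _)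
  Σ-split (suc m) n f = trans (+-congˡ (Σ-split m n (f ∘ suc))) (sym (+-assoc _ _ _))

  telescope : ∀ n (Z f : ℕ → Carrier) → (∀ i → i < n → Z i + f i ≈ Z (suc i)) → Z 0 + Σ n f ≈ Z n
  telescope zero    Z f step = +-identityʳ (Z 0)
  telescope (suc n) Z f step = begin
    Z 0 + (f 0 + Σ n (f ∘ suc))  ≈⟨ +-assoc _ _ _ ⟨
    Z 0 + f 0 + Σ n (f ∘ suc)    ≈⟨ +-congʳ (step 0 (s≤s z≤n)) ⟩
    Z 1 + Σ n (f ∘ suc)          ≈⟨ telescope n (Z ∘ suc) (f ∘ suc) (λ i i<n → step (suc i) (s≤s i<n)) ⟩
    Z (suc n)                    ∎

  transposeˡ : ∀ {a s b} → a + s ≈ b → s ≈ b - a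
  transposeˡ {a} {s} e = trans (solve 2 (λ a s → s := a :+ s :- a) refl a s) (+-congʳ e)

  geometric : ∀ n x → (x - 1#) * Σ n (x ^_) ≈ x ^ n - 1#
  geometric n x = trans (Σ-scaleˡ n (x - 1#) (x ^_)) (transposeˡ (telescope n (x ^_) _ λ i _ →
    solve 2 (λ x a → a :+ (x :- :1) :* a := x :* a) refl x (x ^ i)))

  -- Summation by parts for a step function: multiplying by `y - 1` leaves the two boundary terms
  -- and the jump `α - β` at position `m`.
  two-step-sum : ∀ m n y (h : ℕ → Carrier) α β → (∀ c → c < m → h c ≈ α) → (∀ c → h (m ℕ.+ c) ≈ β) →
    (y - 1#) * Σ (m ℕ.+ n) (λ c → y ^ c * h c) ≈ y ^ m * y ^ n * β - α + y ^ m * (α - β)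
  two-step-sum m n y h α β hα hβ = begin
    (y - 1#) * Σ (m ℕ.+ n) (λ c → y ^ c * h c)
      ≈⟨ *-congˡ (Σ-split m n _) ⟩
    (y - 1#) * (Σ m (λ c → y ^ c * h c) + Σ n (λ c → y ^ (m ℕ.+ c) * h (m ℕ.+ c)))
      ≈⟨ *-congˡ (+-cong
           (trans (Σ-cong m (λ c c<m → trans (*-congˡ (hα c c<m)) (*-comm _ _))) (sym (Σ-scaleˡ m α (y ^_))))
           (trans (Σ-cong n (λ c _ → trans (*-cong (^-homo-* y m c) (hβ c))
               (solve 3 (λ a b c → a :* b :* c := a :* c :* b) refl _ _ _)))
             (sym (Σ-scaleˡ n (y ^ m * β) (y ^_))))) ⟩
    (y - 1#) * (α * Σ m (y ^_) + y ^ m * β * Σ n (y ^_))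
      ≈⟨ solve 6 (λ u α s ym β s′ → u :* (α :* s :+ ym :* β :* s′) := α :* (u :* s) :+ ym :* β :* (u :* s′)) refl _ _ _ _ _ _ ⟩
    α * ((y - 1#) * Σ m (y ^_)) + y ^ m * β * ((y - 1#) * Σ n (y ^_))
      ≈⟨ +-cong (*-congˡ (geometric m y)) (*-congˡ (geometric n y)) ⟩
    α * (y ^ m - 1#) + y ^ m * β * (y ^ n - 1#)
      ≈⟨ solve 4 (λ α β a b → α :* (a :- :1) :+ a :* β :* (b :- :1) := a :* b :* β :- α :+ a :* (α :- β)) refl _ _ _ _ ⟩
    y ^ m * y ^ n * β - α + y ^ m * (α - β) ∎

  -- The explicit cyclotomic polynomial for two primes

  index : ℕ → ℕ → ℕ → ℕ → ℕ
  index p′ k a b = a ℕ.* (k ℕ.* suc p′) ℕ.+ b ℕ.* suc p′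

  -- For primes p = suc p′ and q = k p + 1, this is the cyclotomic polynomial of p q at t.
  Φ₂ : ℕ → ℕ → Carrier → Carrier
  Φ₂ p′ k t =
    Σ p′ (λ a → Σ k λ b → t ^ index p′ k a b - t ^ (index p′ k a b ℕ.+ suc a))
    + t ^ (p′ ℕ.* (k ℕ.* suc p′))

  Φ₂-cong : ∀ p′ k {t t′} → t ≈ t′ → Φ₂ p′ k t ≈ Φ₂ p′ k t′
  Φ₂-cong p′ k e = +-cong
    (Σ-cong p′ λ a _ → Σ-cong k λ b _ → +-cong
      (^-congˡ (index p′ k a b) e) (-‿cong (^-congˡ (index p′ k a b ℕ.+ suc a) e)))
    (^-congˡ (p′ ℕ.* (k ℕ.* suc p′)) e)

  module _ (p′ k : ℕ) where

    private
      p = suc p′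
      m = k ℕ.* p
      q = suc m
      ℓ = index p′ k

    ^-index-suc : ∀ t a b → t ^ ℓ a (suc b) ≈ t ^ ℓ a b * t ^ p
    ^-index-suc t a b = trans (^-congʳ t eq) (^-homo-* t (ℓ a b) p)
      where
      eq : ℓ a (suc b) ≡ ℓ a b ℕ.+ p
      eq = ≡.trans (≡.cong (a ℕ.* m ℕ.+_) (ℕ.+-comm p (b ℕ.* p))) (≡.sym (ℕ.+-assoc (a ℕ.* m) (b ℕ.* p) p))

    ^-index-zero : ∀ t a → t ^ ℓ a 0 ≈ t ^ (a ℕ.* m)
    ^-index-zero t a = ^-congʳ t (ℕ.+-identityʳ (a ℕ.* m))

    ^-*q : ∀ t a → t ^ (a ℕ.* q) ≈ t ^ a * t ^ (a ℕ.* m)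
    ^-*q t a = trans (^-congʳ t (ℕ.*-suc a m)) (^-homo-* t a (a ℕ.* m))

    ^-suc*m : ∀ t a → t ^ (suc a ℕ.* m) ≈ t ^ m * t ^ (a ℕ.* m)
    ^-suc*m t a = ^-homo-* t m (a ℕ.* m)

    -- The factor `t ^ p - 1#` collapses the sum over `b`, which is geometric with ratio `t ^ p`.
    -- What remains is a difference of two geometric sums over `a`, which the factor `t ^ q - 1#`
    -- makes telescope.
    Φ₂-spec : ∀ t →
      Φ₂ p′ k t * ((t ^ p - 1#) * (t ^ q - 1#)) ≈ (t ^ (p ℕ.* q) - 1#) * (t - 1#)
    Φ₂-spec t = begin
      (S + n) * ((t ^ p - 1#) * (t ^ q - 1#))
        ≈⟨ solve 4 (λ s n a b → (s :+ n) :* (a :* b) := b :* (a :* s) :+ n :* a :* b) refl S n (t ^ p - 1#) (t ^ q - 1#) ⟩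
      (t ^ q - 1#) * ((t ^ p - 1#) * S) + n * (t ^ p - 1#) * (t ^ q - 1#)
        ≈⟨ +-congʳ (*-congˡ (trans (Σ-scaleˡ p′ _ _) (Σ-cong p′ λ a _ → inner a))) ⟩
      (t ^ q - 1#) * Σ p′ (λ a → t ^ (a ℕ.* m) * (t ^ m - 1#) * (1# - t ^ suc a)) + n * (t ^ p - 1#) * (t ^ q - 1#)
        ≈⟨ +-congʳ (trans (Σ-scaleˡ p′ _ _) outer) ⟩
      (t ^ q - 1#) * n - (t ^ m - 1#) * t * (w * n)
        - ((t ^ q - 1#) * 1# - (t ^ m - 1#) * t * (1# * 1#)) + n * (t ^ p - 1#) * (t ^ q - 1#)
        ≈⟨ solve 4 (λ t M n w →
             (t :* M :- :1) :* n :- (M :- :1) :* t :* (w :* n)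
               :- ((t :* M :- :1) :* :1 :- (M :- :1) :* t :* (:1 :* :1)) :+ n :* (t :* w :- :1) :* (t :* M :- :1)
             := (t :* M :* (w :* n) :- :1) :* (t :- :1)) refl t (t ^ m) n w ⟩
      (t ^ q * (w * n) - 1#) * (t - 1#)
        ≈⟨ *-congʳ (+-congʳ (trans (^-homo-* t q (p′ ℕ.* q)) (*-congˡ (^-*q t p′)))) ⟨
      (t ^ (p ℕ.* q) - 1#) * (t - 1#) ∎
      where
      S = Σ p′ (λ a → Σ k λ b → t ^ ℓ a b - t ^ (ℓ a b ℕ.+ suc a))
      n = t ^ (p′ ℕ.* m)
      w = t ^ p′

      inner : ∀ a → (t ^ p - 1#) * Σ k (λ b → t ^ ℓ a b - t ^ (ℓ a b ℕ.+ suc a))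
        ≈ t ^ (a ℕ.* m) * (t ^ m - 1#) * (1# - t ^ suc a)
      inner a = begin
        (t ^ p - 1#) * Σ k (λ b → t ^ ℓ a b - t ^ (ℓ a b ℕ.+ suc a))
          ≈⟨ Σ-scaleˡ k _ _ ⟩
        Σ k (λ b → (t ^ p - 1#) * (t ^ ℓ a b - t ^ (ℓ a b ℕ.+ suc a)))
          ≈⟨ transposeˡ (telescope k (λ b → t ^ ℓ a b * (1# - t ^ suc a)) _ λ b _ → begin
               t ^ ℓ a b * (1# - t ^ suc a) + (t ^ p - 1#) * (t ^ ℓ a b - t ^ (ℓ a b ℕ.+ suc a))
                 ≈⟨ +-congˡ (*-congˡ (+-congˡ (-‿cong (^-homo-* t (ℓ a b) (suc a))))) ⟩
               t ^ ℓ a b * (1# - t ^ suc a) + (t ^ p - 1#) * (t ^ ℓ a b - t ^ ℓ a b * t ^ suc a)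
                 ≈⟨ solve 3 (λ e s P → e :* (:1 :- s) :+ (P :- :1) :* (e :- e :* s) := e :* P :* (:1 :- s)) refl (t ^ ℓ a b) (t ^ suc a) (t ^ p) ⟩
               t ^ ℓ a b * t ^ p * (1# - t ^ suc a)
                 ≈⟨ *-congʳ (^-index-suc t a b) ⟨
               t ^ ℓ a (suc b) * (1# - t ^ suc a) ∎) ⟩
        t ^ ℓ a k * (1# - t ^ suc a) - t ^ ℓ a 0 * (1# - t ^ suc a)
          ≈⟨ +-cong (*-congʳ (^-homo-* t (a ℕ.* m) m)) (-‿cong (*-congʳ (^-index-zero t a))) ⟩
        t ^ (a ℕ.* m) * t ^ m * (1# - t ^ suc a) - t ^ (a ℕ.* m) * (1# - t ^ suc a)
          ≈⟨ solve 3 (λ A M s → A :* M :* s :- A :* s := A :* (M :- :1) :* s) refl _ _ _ ⟩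
        t ^ (a ℕ.* m) * (t ^ m - 1#) * (1# - t ^ suc a) ∎

      outer : Σ p′ (λ a → (t ^ q - 1#) * (t ^ (a ℕ.* m) * (t ^ m - 1#) * (1# - t ^ suc a)))
        ≈ (t ^ q - 1#) * n - (t ^ m - 1#) * t * (w * n) - ((t ^ q - 1#) * 1# - (t ^ m - 1#) * t * (1# * 1#))
      -- The two sums over `a` have ratios `t ^ m` and `t ^ q`, with `t ^ a * t ^ (a ℕ.* m)` being
      -- `t ^ (a ℕ.* q)`. The potential adds their geometric primitives over the common denominator
      -- `(t ^ m - 1#) * (t ^ q - 1#)`, of which the first factor already stands in the summand.
      outer = transposeˡ (telescope p′
        (λ a → (t ^ q - 1#) * t ^ (a ℕ.* m) - (t ^ m - 1#) * t * (t ^ a * t ^ (a ℕ.* m))) _ λ a _ → begin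
          (t ^ q - 1#) * t ^ (a ℕ.* m) - (t ^ m - 1#) * t * (t ^ a * t ^ (a ℕ.* m))
            + (t ^ q - 1#) * (t ^ (a ℕ.* m) * (t ^ m - 1#) * (1# - t ^ suc a))
            ≈⟨ solve 4 (λ t M s A → (t :* M :- :1) :* A :- (M :- :1) :* t :* (s :* A)
                 :+ (t :* M :- :1) :* (A :* (M :- :1) :* (:1 :- t :* s))
                 := (t :* M :- :1) :* (M :* A) :- (M :- :1) :* t :* (t :* s :* (M :* A))) refl t (t ^ m) (t ^ a) (t ^ (a ℕ.* m)) ⟩
          (t ^ q - 1#) * (t ^ m * t ^ (a ℕ.* m)) - (t ^ m - 1#) * t * (t ^ suc a * (t ^ m * t ^ (a ℕ.* m)))
            ≈⟨ +-cong (*-congˡ (^-suc*m t a)) (-‿cong (*-congˡ (*-congˡ (^-suc*m t a)))) ⟨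
          (t ^ q - 1#) * t ^ (suc a ℕ.* m) - (t ^ m - 1#) * t * (t ^ suc a * t ^ (suc a ℕ.* m)) ∎)

    -- Summation by parts over the indices of the expansion

    module _ (x y : Carrier) (g : ℕ → ℕ → ℕ → Carrier)
      (g-below : ∀ {a b c} → a < p′ → c ≤ a → (x - 1#) * g a b c ≈ x ^ ℓ a b * (x ^ p - x ^ suc a))
      (g-above : ∀ {a b c} → a < p′ → a < c → (x - 1#) * g a b c ≈ x ^ ℓ a b * x ^ p * (1# - x ^ suc a))
      where

      private
        κ = 1# - x ^ q

        f : ℕ → ℕ → ℕ → Carrier
        f a b c = 1# + g a b c - x ^ (suc a ℕ.* q) - x ^ q * g a b c

        C : ℕ → Carrier
        C a = (x - 1#) * (1# - x ^ (suc a ℕ.* q))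

        -- y^ℓ times the value of (x - 1) f at the index just before ℓ.  Along the enumeration of the
        -- indices this value changes only at exponents e of Φ₂, by ± κ x^e (x^p - 1).
        Z : ℕ → ℕ → Carrier
        Z a b = y ^ ℓ a b * (C a + κ * (x ^ ℓ a b * (1# - x ^ suc a)))

        δ : ℕ → ℕ → Carrier
        δ a b = (x * y) ^ ℓ a b - (x * y) ^ (ℓ a b ℕ.+ suc a)

        row : ℕ → ℕ → Carrier
        row a b = Σ p (λ c → y ^ (ℓ a b ℕ.+ c) * f a b c)

      -- For fixed `a` and `b`, `(x - 1#) * f a b c` is a step function of `c` with its only jump at
      -- `c = suc a`. The summand `C a` does not depend on `c` and drops out of the jump.
      row-closed : ∀ {a} b → a < p′ → (x - 1#) * ((y - 1#) * row a b) ≈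
        y ^ ℓ a b * (y ^ p * (κ * (x ^ ℓ a b * x ^ p * (1# - x ^ suc a)) + C a)
          - (κ * (x ^ ℓ a b * (x ^ p - x ^ suc a)) + C a)
          + y ^ suc a * (κ * (x ^ ℓ a b * (x ^ p - x ^ suc a)) - κ * (x ^ ℓ a b * x ^ p * (1# - x ^ suc a))))
      row-closed {a} b a<p′ = begin
        (x - 1#) * ((y - 1#) * row a b)
          ≈⟨ solve 3 (λ u v s → u :* (v :* s) := v :* (u :* s)) refl _ _ _ ⟩
        (y - 1#) * ((x - 1#) * row a b)
          ≈⟨ *-congˡ (trans (Σ-scaleˡ p (x - 1#) (λ c → y ^ (ℓ a b ℕ.+ c) * f a b c)) (Σ-cong p λ c _ → trans
               (*-congˡ (*-congʳ (^-homo-* y (ℓ a b) c)))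
               (solve 4 (λ u e s f → u :* (e :* s :* f) := e :* (s :* (u :* f))) refl (x - 1#) (y ^ ℓ a b) (y ^ c) (f a b c)))) ⟩
        (y - 1#) * Σ p (λ c → y ^ ℓ a b * (y ^ c * h c))
          ≈⟨ *-congˡ (Σ-scaleˡ p (y ^ ℓ a b) (λ c → y ^ c * h c)) ⟨
        (y - 1#) * (y ^ ℓ a b * Σ p (λ c → y ^ c * h c))
          ≈⟨ solve 3 (λ u v s → u :* (v :* s) := v :* (u :* s)) refl _ _ _ ⟩
        y ^ ℓ a b * ((y - 1#) * Σ p (λ c → y ^ c * h c))
          ≡⟨ ≡.cong (λ n → y ^ ℓ a b * ((y - 1#) * Σ n (λ c → y ^ c * h c))) split ⟨
        y ^ ℓ a b * ((y - 1#) * Σ (suc a ℕ.+ (p′ ∸ a)) (λ c → y ^ c * h c))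
          ≈⟨ *-congˡ (two-step-sum (suc a) (p′ ∸ a) y h α β
               (λ { c (s≤s c≤a) → trans (expand _) (+-congʳ (*-congˡ (g-below a<p′ c≤a))) })
               (λ c → trans (expand _) (+-congʳ (*-congˡ (g-above a<p′ (ℕ.m≤m+n (suc a) c)))))) ⟩
        y ^ ℓ a b * (y ^ suc a * y ^ (p′ ∸ a) * β - α + y ^ suc a * (α - β))
          ≈⟨ *-congˡ (+-cong (+-congʳ (*-congʳ (trans (sym (^-homo-* y (suc a) (p′ ∸ a))) (^-congʳ y split))))
               (*-congˡ (solve 3 (λ u v w → u :+ w :- (v :+ w) := u :- v) refl _ _ _))) ⟩
        y ^ ℓ a b * (y ^ p * β - α
          + y ^ suc a * (κ * (x ^ ℓ a b * (x ^ p - x ^ suc a)) - κ * (x ^ ℓ a b * x ^ p * (1# - x ^ suc a)))) ∎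
        where
        h : ℕ → Carrier
        h c = (x - 1#) * f a b c
        α = κ * (x ^ ℓ a b * (x ^ p - x ^ suc a)) + C a
        β = κ * (x ^ ℓ a b * x ^ p * (1# - x ^ suc a)) + C a
        split : suc a ℕ.+ (p′ ∸ a) ≡ p
        split = ≡.cong suc (ℕ.m+[n∸m]≡n (ℕ.<⇒≤ a<p′))
        expand : ∀ c → h c ≈ κ * ((x - 1#) * g a b c) + C a
        expand c = solve 4 (λ u g s Q → u :* (:1 :+ g :- s :- Q :* g) := (:1 :- Q) :* (u :* g) :+ u :* (:1 :- s)) refl
          (x - 1#) (g a b c) (x ^ (suc a ℕ.* q)) (x ^ q)

      -- A row has two jumps: entering it at `c = 0` changes the value by
      -- `κ * x ^ ℓ a b * (x ^ p - 1#)`, and crossing `c = suc a` changes it by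
      -- `- κ * x ^ (ℓ a b + suc a) * (x ^ p - 1#)`. Weighted with the matching powers of `y`, they
      -- add up to `κ * (x ^ p - 1#) * δ a b`.
      Z-step : ∀ {a} b → a < p′ →
        Z a b + ((x - 1#) * ((y - 1#) * row a b) + κ * (x ^ p - 1#) * δ a b) ≈ Z a (suc b)
      Z-step {a} b a<p′ = begin
        Z a b + ((x - 1#) * ((y - 1#) * row a b) + κ * (x ^ p - 1#) * δ a b)
          ≈⟨ +-congˡ (+-cong (row-closed b a<p′) (*-congˡ δ-split)) ⟩
        e′ * (C a + κ * (e * (1# - s)))
          + (e′ * (P′ * (κ * (e * P * (1# - s)) + C a) - (κ * (e * (P - s)) + C a)
            + s′ * (κ * (e * (P - s)) - κ * (e * P * (1# - s))))
          + κ * (P - 1#) * (e * e′ - e * e′ * (s * s′)))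
          ≈⟨ solve 8 (λ e e′ s s′ P P′ κ C →
               e′ :* (C :+ κ :* (e :* (:1 :- s)))
                 :+ (e′ :* (P′ :* (κ :* (e :* P :* (:1 :- s)) :+ C) :- (κ :* (e :* (P :- s)) :+ C)
                   :+ s′ :* (κ :* (e :* (P :- s)) :- κ :* (e :* P :* (:1 :- s))))
                 :+ κ :* (P :- :1) :* (e :* e′ :- e :* e′ :* (s :* s′)))
               := e′ :* P′ :* (C :+ κ :* (e :* P :* (:1 :- s)))) refl e e′ s s′ P P′ κ (C a) ⟩
        e′ * P′ * (C a + κ * (e * P * (1# - s)))
          ≈⟨ *-cong (^-index-suc y a b) (+-congˡ (*-congˡ (*-congʳ (^-index-suc x a b)))) ⟨
        Z a (suc b) ∎
        where
        e = x ^ ℓ a b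
        e′ = y ^ ℓ a b
        s = x ^ suc a
        s′ = y ^ suc a
        P = x ^ p
        P′ = y ^ p
        δ-split : δ a b ≈ e * e′ - e * e′ * (s * s′)
        δ-split = +-cong (^-distrib-* x y (ℓ a b)) (-‿cong (trans (^-homo-* (x * y) (ℓ a b) (suc a))
          (*-cong (^-distrib-* x y (ℓ a b)) (^-distrib-* x y (suc a)))))

      -- Passing to the next `a` replaces `1# - x ^ suc a` by `1# - x ^ suc (suc a)`; the change
      -- from `C a` to `C (suc a)` compensates this exactly, so no correction arises between the
      -- last row of one `a` and the first row of the next.
      Z-wrap : ∀ a → Z a k ≈ Z (suc a) 0
      Z-wrap a = begin
        y ^ (a ℕ.* m ℕ.+ m) * ((x - 1#) * (1# - x ^ (suc a ℕ.* q)) + κ * (x ^ (a ℕ.* m ℕ.+ m) * (1# - x ^ suc a)))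
          ≈⟨ *-cong (^-congʳ y m+) (+-cong (*-congˡ (+-congˡ (-‿cong (^-*q x (suc a))))) (*-congˡ (*-congʳ (^-congʳ x m+)))) ⟩
        y ^ (suc a ℕ.* m) * ((x - 1#) * (1# - s * M) + κ * (M * (1# - s)))
          ≈⟨ solve 5 (λ x N M s Q → N :* ((x :- :1) :* (:1 :- s :* M) :+ (:1 :- Q) :* (M :* (:1 :- s)))
               := N :* ((x :- :1) :* (:1 :- Q :* (s :* M)) :+ (:1 :- Q) :* (M :* (:1 :- x :* s)))) refl
               x (y ^ (suc a ℕ.* m)) M s (x ^ q) ⟩
        y ^ (suc a ℕ.* m) * ((x - 1#) * (1# - x ^ q * (s * M)) + κ * (M * (1# - x * s)))
          ≈⟨ *-cong (^-index-zero y (suc a)) (+-cong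
               (*-congˡ (+-congˡ (-‿cong (trans (^-homo-* x q (suc a ℕ.* q)) (*-congˡ (^-*q x (suc a)))))))
               (*-congˡ (*-congʳ (^-index-zero x (suc a))))) ⟨
        Z (suc a) 0 ∎
        where
        s = x ^ suc a
        M = x ^ (suc a ℕ.* m)
        m+ : a ℕ.* m ℕ.+ m ≡ suc a ℕ.* m
        m+ = ℕ.+-comm (a ℕ.* m) m

      -- Summation by parts starts from the value 0 before the first index, and the formula for `Z`
      -- agrees with that: `C 0` is cancelled by `κ * (1# - x)`.
      Z-origin : Z 0 0 ≈ 0#
      Z-origin = trans (trans (*-congˡ (+-congʳ (*-congˡ (+-congˡ (-‿cong (^-congʳ x (ℕ.+-identityʳ q)))))))
        (solve 2 (λ x Q → :1 :* ((x :- :1) :* (:1 :- Q) :+ (:1 :- Q) :* (:1 :* (:1 :- x :* :1))) := con 0ℤ)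
          refl x (x ^ q))) 0-homo

      private
        W = Σ p′ (λ a → Σ k (row a))

      Σ-scaleˡ₂ : ∀ c (h : ℕ → ℕ → Carrier) → c * Σ p′ (λ a → Σ k (h a)) ≈ Σ p′ (λ a → Σ k λ b → c * h a b)
      Σ-scaleˡ₂ c h = trans (Σ-scaleˡ p′ c _) (Σ-cong p′ λ a _ → Σ-scaleˡ k c (h a))

      telescoped : (x - 1#) * ((y - 1#) * W) + κ * (x ^ p - 1#) * Σ p′ (λ a → Σ k (δ a)) ≈ Z p′ 0
      telescoped = begin
        (x - 1#) * ((y - 1#) * W) + κ * (x ^ p - 1#) * Σ p′ (λ a → Σ k (δ a))
          ≈⟨ +-cong (trans (*-congˡ (Σ-scaleˡ₂ _ row)) (Σ-scaleˡ₂ _ _)) (Σ-scaleˡ₂ _ δ) ⟩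
        Σ p′ (λ a → Σ k λ b → (x - 1#) * ((y - 1#) * row a b)) + Σ p′ (λ a → Σ k λ b → κ * (x ^ p - 1#) * δ a b)
          ≈⟨ trans (Σ-+ p′ _ _) (Σ-cong p′ λ a _ → Σ-+ k _ _) ⟩
        ΔZ
          ≈⟨ +-identityˡ ΔZ ⟨
        0# + ΔZ
          ≈⟨ +-congʳ Z-origin ⟨
        Z 0 0 + ΔZ
          ≈⟨ telescope p′ (λ a → Z a 0) _ (λ a a<p′ →
               trans (telescope k (Z a) _ λ b _ → Z-step b a<p′) (Z-wrap a)) ⟩
        Z p′ 0 ∎
        where
        ΔZ = Σ p′ (λ a → Σ k λ b → (x - 1#) * ((y - 1#) * row a b) + κ * (x ^ p - 1#) * δ a b)

      factorization : ∀ T D → (x ^ (p ℕ.* q) - 1#) * D ≈ y - 1# →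
        T ≈ W * D + y ^ (p′ ℕ.* m) →
        (x - 1#) * (x ^ (p ℕ.* q) - 1#) * T ≈ (x ^ p - 1#) * (x ^ q - 1#) * Φ₂ p′ k (x * y)
      factorization T D hD hT = begin
        (x - 1#) * U * T
          ≈⟨ *-congˡ hT ⟩
        (x - 1#) * U * (W * D + N)
          ≈⟨ solve 5 (λ u U W D N → u :* U :* (W :* D :+ N) := u :* ((U :* D) :* W) :+ u :* U :* N) refl _ _ _ _ _ ⟩
        (x - 1#) * ((U * D) * W) + (x - 1#) * U * N
          ≈⟨ +-congʳ (*-congˡ (*-congʳ hD)) ⟩
        (x - 1#) * ((y - 1#) * W) + (x - 1#) * U * N
          ≈⟨ +-congʳ (solve 2 (λ a b → a := b :+ a :- b) refl _ B) ⟩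
        B + (x - 1#) * ((y - 1#) * W) - B + (x - 1#) * U * N
          ≈⟨ +-congʳ (+-congʳ (trans (+-comm _ _) telescoped)) ⟩
        Z p′ 0 - B + (x - 1#) * U * N
          ≈⟨ +-congʳ (+-congʳ (*-cong (^-index-zero y p′) (+-congˡ (*-congˡ (*-congʳ (^-index-zero x p′)))))) ⟩
        N * (C p′ + κ * (M * (1# - P))) - B + (x - 1#) * U * N
          -- The last monomial `N`, multiplied by `(x - 1#) * U`, cancels the contribution
          -- `N * C p′`. The other part of the end value supplies the leading term `M * N` of `Φ₂`.
          ≈⟨ solve 7 (λ x N V M P Q S →
               N :* ((x :- :1) :* (:1 :- V) :+ (:1 :- Q) :* (M :* (:1 :- P))) :- (:1 :- Q) :* (P :- :1) :* S
                 :+ (x :- :1) :* (V :- :1) :* N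
               := (P :- :1) :* (Q :- :1) :* (S :+ M :* N)) refl x N (x ^ (p ℕ.* q)) M P (x ^ q) S ⟩
        (P - 1#) * (x ^ q - 1#) * (S + M * N)
          ≈⟨ *-congˡ (+-congˡ (^-distrib-* x y (p′ ℕ.* m))) ⟨
        (P - 1#) * (x ^ q - 1#) * Φ₂ p′ k (x * y) ∎
        where
        U = x ^ (p ℕ.* q) - 1#
        N = y ^ (p′ ℕ.* m)
        M = x ^ (p′ ℕ.* m)
        P = x ^ p
        S = Σ p′ (λ a → Σ k (δ a))
        B = κ * (P - 1#) * S

open import Defs
open import Data.Empty using (⊥-elim)
open import Data.List using (List; []; _∷_; _++_; _∷ʳ_; [_]; map; reverse; foldl; foldr;
  replicate; dropWhile; length; upTo; applyUpTo; concat; concatMap; filter)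
import Data.List.Properties as List
open import Data.List.Membership.Propositional using (_∈_)
open import Data.List.Membership.Propositional.Properties
  using (∈-filter⁺; ∈-filter⁻; ∈-map⁺; ∈-map⁻; ∈-upTo⁺; ∈-upTo⁻; ∈-++⁺ˡ)
open import Data.List.Membership.Propositional.Properties.WithK using (unique∧set⇒bag)
open import Data.List.Relation.Binary.BagAndSetEquality using (∼bag⇒↭)
open import Data.List.Relation.Binary.Permutation.Propositional as ↭ using (_↭_)
open import Data.List.Relation.Binary.Permutation.Propositional.Properties using ()
  renaming (map⁺ to ↭-map⁺)
open import Data.List.Relation.Binary.Pointwise using (Pointwise; []; _∷_)
open import Data.List.Relation.Unary.All as All using (All; []; _∷_)
open import Data.List.Relation.Unary.AllPairs as AllPairs using (AllPairs; []; _∷_)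
open import Data.List.Relation.Unary.Any using (here; there)
open import Data.List.Relation.Unary.Linked using (Linked; []; [-]; _∷_)
open import Data.List.Relation.Unary.Linked.Properties using (Linked⇒AllPairs)
open import Data.List.Relation.Unary.Unique.Propositional using (Unique)
import Data.List.Relation.Unary.Unique.Propositional.Properties as Unique
open import Data.Nat using (_+_; _*_; _≤?_)
open import Data.Nat.Coprimality as Coprime using (Coprime; coprime?; coprime-divisor)
open import Data.Nat.Divisibility
open import Data.Nat.DivMod using (_/_; +-distrib-/-∣ʳ; m<n⇒m/n≡0; m*n/n≡m)
open import Data.Nat.Primality using (Prime; prime⇒irreducible; prime⇒nonZero; prime⇒nonTrivial)
open import Data.Product using (∃; _,_; _×_; proj₁; proj₂; ∃-syntax)
open import Data.Sum using (_⊎_; inj₁; inj₂; map₁)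
open import Relation.Binary.PropositionalEquality
  using (_≡_; _≢_; refl; sym; trans; cong; cong₂; subst; subst₂; module ≡-Reasoning)
open import Relation.Nullary using (¬_; Dec; yes; no)
open import Relation.Unary using (Decidable)

-- Arithmetic of the exponents

module _ where

  open ℕSolver.+-*-Solver

  dotρ-collect : ∀ a b c d m p r n →
    a * (m * r) + b * (p * r) + c * r + d * n ≡ r * (a * m + b * p + c) + n * d
  dotρ-collect = solve 8 (λ a b c d m p r n →
    a :* (m :* r) :+ b :* (p :* r) :+ c :* r :+ d :* n := r :* (a :* m :+ b :* p :+ c) :+ n :* d) refl

  start-below : ∀ a b m p → a * suc m + b * p + 1 ≡ a * m + b * p + suc a
  start-below = solve 4 (λ a b m p →
    a :* (con 1 :+ m) :+ b :* p :+ con 1 := a :* m :+ b :* p :+ (con 1 :+ a)) refl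

  start-above : ∀ a b m p → a * m + (b + 1) * p ≡ a * m + b * p + p
  start-above = solve 4 (λ a b m p → a :* m :+ (b :+ con 1) :* p := a :* m :+ b :* p :+ p) refl

  below-top : ∀ a b q n → a * q + b * suc n + 1 + n ≡ a * q + suc b * suc n
  below-top = solve 4 (λ a b q n →
    a :* q :+ b :* (con 1 :+ n) :+ con 1 :+ n := a :* q :+ (con 1 :+ b) :* (con 1 :+ n)) refl

  above-top : ∀ a m → a * m + m + (a + 1) ≡ suc a * suc m
  above-top = solve 2 (λ a m → a :* m :+ m :+ (a :+ con 1) := (con 1 :+ a) :* (con 1 :+ m)) refl

-- Divisors and the totient

Linked⇒Unique : ∀ {xs} → Linked _<_ xs → Unique xs
Linked⇒Unique = AllPairs.map ℕ.<⇒≢ ∘ Linked⇒AllPairs ℕ.<-trans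

AllPairs-∷ʳ⁻ : ∀ xs {n} → AllPairs _<_ (xs ∷ʳ n) → AllPairs _<_ xs × All (_< n) xs
AllPairs-∷ʳ⁻ []       _            = [] , []
AllPairs-∷ʳ⁻ (x ∷ xs) (x< ∷ pairs) with AllPairs-∷ʳ⁻ xs pairs | All-∷ʳ⁻ xs x<
  where
  All-∷ʳ⁻ : ∀ xs {x n} → All (x <_) (xs ∷ʳ n) → All (x <_) xs × x < n
  All-∷ʳ⁻ []       (x<n ∷ []) = [] , x<n
  All-∷ʳ⁻ (y ∷ ys) (x<y ∷ rest) with All-∷ʳ⁻ ys rest
  ... | x<ys , x<n = x<y ∷ x<ys , x<n
... | pairs′ , <n | x<xs , x<n = x<xs ∷ pairs′ , x<n ∷ <n

-- The single chain `0 ∷ ds ∷ʳ n` encodes that the listed divisors are positive, distinct and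
-- smaller than `n`. Two lists without repetitions and with the same members are permutations of
-- each other, which is enough for a commutative product.
properDivisors-↭ : ∀ n ds → Linked _<_ (0 ∷ ds ∷ʳ n) → All (_∣ n) ds →
  (∀ {d} → d ∣ n → d ∈ ds ⊎ d ≡ n) → properDivisors n ↭ ds
properDivisors-↭ n ds sorted divide complete with Linked⇒AllPairs ℕ.<-trans sorted
... | 0< ∷ pairs with AllPairs-∷ʳ⁻ ds pairs
... | ds-sorted , <n = ∼bag⇒↭ (unique∧set⇒bag
  (Unique.filter⁺ (_∣? n) (Unique.map⁺ ℕ.suc-injective (Unique.upTo⁺ (n ∸ 1))))
  (AllPairs.map ℕ.<⇒≢ ds-sorted)
  (mk⇔ to from))
  where
  to : ∀ {d} → d ∈ properDivisors n → d ∈ ds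
  to d∈ with ∈-filter⁻ (_∣? n) {xs = map suc (upTo (n ∸ 1))} d∈
  ... | d∈′ , d∣n with ∈-map⁻ suc d∈′
  ... | i , i∈ , refl with complete d∣n
  ... | inj₁ d∈ds = d∈ds
  ... | inj₂ refl = ⊥-elim (ℕ.<-irrefl refl (∈-upTo⁻ i∈))
  from : ∀ {d} → d ∈ ds → d ∈ properDivisors n
  from {d} d∈ = ∈-filter⁺ (_∣? n)
    (positive (All.lookup 0< (∈-++⁺ˡ d∈)) (All.lookup <n d∈)) (All.lookup divide d∈)
    where
    positive : ∀ {d n} → 0 < d → d < n → d ∈ map suc (upTo (n ∸ 1))
    positive {suc d} {suc n} _ (s≤s d<n) = ∈-map⁺ suc (∈-upTo⁺ d<n)

coprime-or-divides : ∀ {p} n → Prime p → Coprime p n ⊎ p ∣ n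
coprime-or-divides {p} n pp with p ∣? n
... | yes p∣n = inj₂ p∣n
... | no  p∤n = inj₁ λ {i} (i∣p , i∣n) → irreducible i∣p i∣n
  where
  irreducible : ∀ {i} → i ∣ p → i ∣ n → i ≡ 1
  irreducible i∣p i∣n with prime⇒irreducible pp i∣p
  ... | inj₁ i≡1  = i≡1
  ... | inj₂ refl = ⊥-elim (p∤n i∣n)

divisors-prime* : ∀ {p} n {d} → Prime p → d ∣ p * n → d ∣ n ⊎ ∃[ e ] d ≡ p * e × e ∣ n
divisors-prime* {p} n {d} pp d∣pn with coprime-or-divides d pp
... | inj₁ coprime = inj₁ (coprime-divisor (Coprime.sym coprime) d∣pn)
... | inj₂ (divides e refl) rewrite ℕ.*-comm e p =
  inj₂ (e , refl , *-cancelˡ-∣ p {{prime⇒nonZero pp}} d∣pn)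

prime>1 : ∀ {p} → Prime p → 1 < p
prime>1 {p} pp = ℕ.nonTrivial⇒n>1 p {{prime⇒nonTrivial pp}}

divisors-pq : ∀ {p q d} → Prime p → Prime q → d ∣ p * q → d ∈ 1 ∷ p ∷ q ∷ [] ⊎ d ≡ p * q
divisors-pq {p} {q} pp pq d∣ with divisors-prime* q pp d∣
... | inj₁ d∣q with prime⇒irreducible pq d∣q
...   | inj₁ refl = inj₁ (here refl)
...   | inj₂ refl = inj₁ (there (there (here refl)))
divisors-pq {p} {q} pp pq d∣ | inj₂ (e , refl , e∣q) with prime⇒irreducible pq e∣q
...   | inj₁ refl = inj₁ (there (here (ℕ.*-identityʳ p)))
...   | inj₂ refl = inj₂ refl

divisors-pqr : ∀ {p q r d} → Prime p → Prime q → Prime r → d ∣ p * q * r →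
  d ∈ 1 ∷ p ∷ q ∷ p * q ∷ r ∷ p * r ∷ q * r ∷ [] ⊎ d ≡ p * q * r
divisors-pqr {p} {q} {r} {d} pp pq pr d∣ with divisors-prime* (q * r) pp (subst (d ∣_) (ℕ.*-assoc p q r) d∣)
... | inj₁ d∣qr with divisors-pq pq pr d∣qr
...   | inj₁ (here eq)                 = inj₁ (here eq)
...   | inj₁ (there (here eq))         = inj₁ (there (there (here eq)))
...   | inj₁ (there (there (here eq))) = inj₁ (there (there (there (there (here eq)))))
...   | inj₂ eq                        = inj₁ (there (there (there (there (there (there (here eq)))))))
divisors-pqr {p} {q} {r} pp pq pr d∣ | inj₂ (e , refl , e∣qr) with divisors-pq pq pr e∣qr
...   | inj₁ (here refl)                 = inj₁ (there (here (ℕ.*-identityʳ p)))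
...   | inj₁ (there (here refl))         = inj₁ (there (there (there (here refl))))
...   | inj₁ (there (there (here refl))) = inj₁ (there (there (there (there (there (here refl))))))
...   | inj₂ refl                        = inj₂ (sym (ℕ.*-assoc p q r))

properDivisors-p : ∀ {p} → Prime p → properDivisors p ↭ 1 ∷ []
properDivisors-p {p} pp = properDivisors-↭ p (1 ∷ []) (s≤s z≤n ∷ prime>1 pp ∷ [-]) (1∣ p ∷ [])
  λ d∣p → map₁ here (prime⇒irreducible pp d∣p)

n<m*n : ∀ {m n} → 1 < m → 0 < n → n < m * n
n<m*n {m} {suc n} 1<m _ = subst (suc n <_) (ℕ.*-comm (suc n) m) (ℕ.m<m*n (suc n) m 1<m)

properDivisors-pq : ∀ {p q} → Prime p → Prime q → p < q → properDivisors (p * q) ↭ 1 ∷ p ∷ q ∷ []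
properDivisors-pq {p} {q} pp pq p<q = properDivisors-↭ (p * q) _
  (s≤s z≤n ∷ prime>1 pp ∷ p<q ∷ n<m*n (prime>1 pp) (ℕ.<-trans (s≤s z≤n) (prime>1 pq)) ∷ [-])
  (1∣ _ ∷ m∣m*n q ∷ n∣m*n p ∷ [])
  (divisors-pq pp pq)

-- The listed order is ascending thanks to `p * q < r`, which places all divisors of `p * q` before
-- the multiples of `r`.
properDivisors-pqr : ∀ {p q r} → Prime p → Prime q → Prime r → p < q → p * q < r →
  properDivisors (p * q * r) ↭ 1 ∷ p ∷ q ∷ p * q ∷ r ∷ p * r ∷ q * r ∷ []
properDivisors-pqr {p} {q} {r} pp pq pr p<q pq<r = properDivisors-↭ (p * q * r) _
  (s≤s z≤n ∷ prime>1 pp ∷ p<q ∷ n<m*n (prime>1 pp) 0<q ∷ pq<r ∷ n<m*n (prime>1 pp) 0<r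
    ∷ ℕ.*-monoˡ-< r {{prime⇒nonZero pr}} p<q
    ∷ subst (q * r <_) (sym (ℕ.*-assoc p q r)) (n<m*n (prime>1 pp) (ℕ.*-mono-< 0<q 0<r)) ∷ [-])
  (1∣ _ ∷ ∣-trans (m∣m*n q) pq∣ ∷ ∣-trans (n∣m*n p) pq∣ ∷ pq∣ ∷ n∣m*n (p * q)
    ∷ *-monoˡ-∣ r (m∣m*n {p} q) ∷ *-monoˡ-∣ r (n∣m*n p {q}) ∷ [])
  (divisors-pqr pp pq pr)
  where
  0<q = ℕ.<-trans (s≤s z≤n) (prime>1 pq)
  0<r = ℕ.<-trans (s≤s z≤n) (prime>1 pr)
  pq∣ = m∣m*n {p * q} r

sumTo : ℕ → (ℕ → ℕ) → ℕ
sumTo zero    f = 0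
sumTo (suc n) f = f 0 + sumTo n (f ∘ suc)

sumTo-cong : ∀ n {f g} → (∀ i → i < n → f i ≡ g i) → sumTo n f ≡ sumTo n g
sumTo-cong zero    e = refl
sumTo-cong (suc n) e = cong₂ _+_ (e 0 (s≤s z≤n)) (sumTo-cong n λ i i<n → e (suc i) (s≤s i<n))

sumTo-+ : ∀ n f g → sumTo n (λ i → f i + g i) ≡ sumTo n f + sumTo n g
sumTo-+ zero    f g = refl
sumTo-+ (suc n) f g rewrite sumTo-+ n (f ∘ suc) (g ∘ suc) =
  solve 4 (λ a b c d → a :+ b :+ (c :+ d) := a :+ c :+ (b :+ d)) refl (f 0) (g 0) (sumTo n (f ∘ suc)) (sumTo n (g ∘ suc))
  where open ℕSolver.+-*-Solver

sumTo-split : ∀ m n f → sumTo (m + n) f ≡ sumTo m f + sumTo n (f ∘ (m +_))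
sumTo-split zero    n f = refl
sumTo-split (suc m) n f rewrite sumTo-split m n (f ∘ suc) = sym (ℕ.+-assoc (f 0) _ _)

sumTo-blocks : ∀ m p f → sumTo (m * p) f ≡ sumTo m (λ j → sumTo p (λ i → f (j * p + i)))
sumTo-blocks zero    p f = refl
sumTo-blocks (suc m) p f = trans (sumTo-split p (m * p) f) (cong (sumTo p f +_)
  (trans (sumTo-blocks m p (f ∘ (p +_)))
    (sumTo-cong m λ j _ → sumTo-cong p λ i _ → cong f (sym (ℕ.+-assoc p (j * p) i)))))

sumTo-periodic : ∀ p m f → (∀ k → f (m + k) ≡ f k) → sumTo (p * m) f ≡ p * sumTo m f
sumTo-periodic zero    m f periodic = refl
sumTo-periodic (suc p) m f periodic = trans (sumTo-split m (p * m) f) (cong (sumTo m f +_)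
  (trans (sumTo-cong (p * m) λ k _ → periodic k) (sumTo-periodic p m f periodic)))

sumTo-last : ∀ n f → (∀ i → i < n → f i ≡ 0) → sumTo (suc n) f ≡ f n
sumTo-last zero    f e = ℕ.+-identityʳ (f 0)
sumTo-last (suc n) f e rewrite e 0 (s≤s z≤n) = sumTo-last n (f ∘ suc) λ i i<n → e (suc i) (s≤s i<n)

indicator : ∀ {P : Set} → Dec P → ℕ
indicator (yes _) = 1
indicator (no  _) = 0

indicator-cong : ∀ {P Q : Set} (p? : Dec P) (q? : Dec Q) → (P → Q) → (Q → P) → indicator p? ≡ indicator q?
indicator-cong (yes p) (yes q) f g = refl
indicator-cong (yes p) (no ¬q) f g = ⊥-elim (¬q (f p))
indicator-cong (no ¬p) (yes q) f g = ⊥-elim (¬p (g q))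
indicator-cong (no ¬p) (no ¬q) f g = refl

length-filter : ∀ {P : ℕ → Set} (P? : Decidable P) n f →
  length (filter P? (applyUpTo f n)) ≡ sumTo n (indicator ∘ P? ∘ f)
length-filter P? zero    f = refl
length-filter P? (suc n) f with P? (f 0)
... | yes _ = cong suc (length-filter P? n (f ∘ suc))
... | no  _ = length-filter P? n (f ∘ suc)

φ-sumTo : ∀ n → φ n ≡ sumTo n (λ k → indicator (coprime? (suc k) n))
φ-sumTo n = trans (cong (length ∘ filter (λ k → coprime? k n)) (List.map-applyUpTo (λ k → k) suc n))
  (length-filter (λ k → coprime? k n) n suc)

-- By periodicity, `p * φ m` of the numbers `1, …, p * m` are coprime to `m`. Those among them
-- divisible by `p` are the `p * j` with `j ≤ m` coprime to `m`, which are `φ m` in number; the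
-- others are the ones coprime to `p * m`. Adding `φ m` on both sides avoids subtraction in ℕ.
φ-prime* : ∀ {p′} m → Prime (suc p′) → Coprime (suc p′) m → φ (suc p′ * m) ≡ p′ * φ m
φ-prime* {p′} m pp coprime = ℕ.+-cancelʳ-≡ (φ m) _ _ (begin
  φ (p * m) + φ m
    ≡⟨ cong₂ _+_ (φ-sumTo (p * m)) (sym multiples) ⟩
  sumTo (p * m) (λ k → indicator (coprime? (suc k) (p * m))) + sumTo (p * m) (λ k → multiple (suc k))
    ≡⟨ sumTo-+ (p * m) _ _ ⟨
  sumTo (p * m) (λ k → indicator (coprime? (suc k) (p * m)) + multiple (suc k))
    ≡⟨ sumTo-cong (p * m) (λ k _ → sieve (suc k)) ⟩
  sumTo (p * m) (λ k → indicator (coprime? (suc k) m))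
    ≡⟨ sumTo-periodic p m _ (λ k → indicator-cong _ _ (shift⁻ k) (shift⁺ k)) ⟩
  p * sumTo m (λ k → indicator (coprime? (suc k) m))
    ≡⟨ cong (p *_) (φ-sumTo m) ⟨
  p * φ m
    ≡⟨ ℕ.+-comm (φ m) (p′ * φ m) ⟩
  p′ * φ m + φ m ∎)
  where
  open ≡-Reasoning
  p = suc p′

  multiple : ℕ → ℕ
  multiple k with p ∣? k
  ... | yes _ = indicator (coprime? k m)
  ... | no  _ = 0

  shift⁻ : ∀ k → Coprime (suc (m + k)) m → Coprime (suc k) m
  shift⁻ k c {d} (d∣k , d∣m) = c (subst (d ∣_) (ℕ.+-suc m k) (∣m∣n⇒∣m+n d∣m d∣k) , d∣m)

  shift⁺ : ∀ k → Coprime (suc k) m → Coprime (suc (m + k)) m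
  shift⁺ k c {d} (d∣m+k , d∣m) = c (∣m+n∣m⇒∣n (subst (d ∣_) (sym (ℕ.+-suc m k)) d∣m+k) d∣m , d∣m)

  sieve : ∀ k → indicator (coprime? k (p * m)) + multiple k ≡ indicator (coprime? k m)
  sieve k with p ∣? k
  ... | yes p∣k = cong (_+ indicator (coprime? k m)) (not-coprime (coprime? k (p * m)))
    where
    not-coprime : ∀ c? → indicator {Coprime k (p * m)} c? ≡ 0
    not-coprime (no _)  = refl
    not-coprime (yes c) = ⊥-elim (ℕ.<⇒≢ (prime>1 pp) (sym (c (p∣k , m∣m*n m))))
  ... | no p∤k = trans (ℕ.+-identityʳ _) (indicator-cong _ _
    (λ c (d∣k , d∣m) → c (d∣k , ∣n⇒∣m*n p d∣m))
    (λ c {d} (d∣k , d∣pm) → to-pm c d∣k (divisors-prime* m pp d∣pm)))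
    where
    to-pm : ∀ {d} → Coprime k m → d ∣ k → d ∣ m ⊎ (∃[ e ] d ≡ p * e × e ∣ m) → d ≡ 1
    to-pm c d∣k (inj₁ d∣m) = c (d∣k , d∣m)
    to-pm c d∣k (inj₂ (e , refl , _)) = ⊥-elim (p∤k (m*n∣⇒m∣ p e d∣k))

  multiples : sumTo (p * m) (λ k → multiple (suc k)) ≡ φ m
  multiples = begin
    sumTo (p * m) (λ k → multiple (suc k))
      ≡⟨ cong (λ n → sumTo n (λ k → multiple (suc k))) (ℕ.*-comm p m) ⟩
    sumTo (m * p) (λ k → multiple (suc k))
      ≡⟨ sumTo-blocks m p (λ k → multiple (suc k)) ⟩
    sumTo m (λ j → sumTo p (λ i → multiple (suc (j * p + i))))
      -- Since the counted number is `suc (j * p + i)`, the multiple of `p` in each block of length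
      -- `p` is its last entry, `i = p′`, and equals `suc j * p`.
      ≡⟨ sumTo-cong m (λ j _ → trans (sumTo-last p′ _ (interior j)) (end j)) ⟩
    sumTo m (λ j → indicator (coprime? (suc j) m))
      ≡⟨ φ-sumTo m ⟨
    φ m ∎
    where
    interior : ∀ j i → i < p′ → multiple (suc (j * p + i)) ≡ 0
    interior j i i<p′ with p ∣? suc (j * p + i)
    ... | no  _ = refl
    ... | yes p∣ = ⊥-elim (ℕ.<⇒≱ (s≤s i<p′) (∣⇒≤ (∣m+n∣m⇒∣n (subst (p ∣_) (sym (ℕ.+-suc (j * p) i)) p∣) (n∣m*n j))))
    end : ∀ j → multiple (suc (j * p + p′)) ≡ indicator (coprime? (suc j) m)
    end j with p ∣? suc (j * p + p′)
    ... | no p∤ = ⊥-elim (p∤ (subst (p ∣_) (ℕ.+-suc (j * p) p′) (∣m∣n⇒∣m+n (n∣m*n j) ∣-refl)))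
    ... | yes _ = indicator-cong _ _
      (λ c {d} (d∣j , d∣m) → c (subst (d ∣_) eq (∣m⇒∣m*n p d∣j) , d∣m))
      (λ c {d} (d∣jp , d∣m) → c (coprime-divisor {m = d} {n = p}
          (λ (i∣d , i∣p) → coprime (i∣p , ∣-trans i∣d d∣m))
          (subst (d ∣_) (trans (sym eq) (ℕ.*-comm (suc j) p)) d∣jp) , d∣m))
      where
      eq : suc j * p ≡ suc (j * p + p′)
      eq = cong suc (ℕ.+-comm p′ (j * p))

-- The largest prime is removed first: it exceeds the remaining cofactor, so coprimality follows
-- from size alone. The last step uses that `φ 1` computes to 1.
φ-pqr : ∀ {p′ q′ r′} → let p = suc p′ ; q = suc q′ ; r = suc r′ in
  Prime p → Prime q → Prime r → p < q → p * q < r → φ (p * q * r) ≡ p′ * q′ * r′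
φ-pqr {p′} {q′} {r′} pp pq pr p<q pq<r = begin
  φ (p * q * r)              ≡⟨ cong φ (ℕ.*-comm (p * q) r) ⟩
  φ (r * (p * q))            ≡⟨ φ-prime* (p * q) pr (coprime-larger pr pq<r (ℕ.*-mono-< {0} {p} {0} {q} (s≤s z≤n) (s≤s z≤n))) ⟩
  r′ * φ (p * q)             ≡⟨ cong (λ n → r′ * φ n) (ℕ.*-comm p q) ⟩
  r′ * φ (q * p)             ≡⟨ cong (r′ *_) (φ-prime* p pq (coprime-larger pq p<q (s≤s z≤n))) ⟩
  r′ * (q′ * φ p)            ≡⟨ cong (λ n → r′ * (q′ * φ n)) (ℕ.*-identityʳ p) ⟨
  r′ * (q′ * φ (p * 1))      ≡⟨ cong (λ n → r′ * (q′ * n)) (φ-prime* 1 pp (λ (_ , d∣1) → ∣1⇒≡1 d∣1)) ⟩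
  r′ * (q′ * (p′ * 1))       ≡⟨ solve 3 (λ p q r → r :* (q :* (p :* con 1)) := p :* q :* r) refl p′ q′ r′ ⟩
  p′ * q′ * r′ ∎
  where
  open ≡-Reasoning
  open ℕSolver.+-*-Solver
  p = suc p′
  q = suc q′
  r = suc r′
  coprime-larger : ∀ {p n} → Prime p → n < p → 0 < n → Coprime p n
  coprime-larger {n = suc n} pp n<p _ = Coprime.prime⇒coprime pp n<p

-- Formal power series over ℤ

Series : Set
Series = ℕ → ℤ

infix 4 _≋_
-- A record instead of the bare pointwise statement, so that unification can read `f` and `g` off
-- the type `f ≋ g`.
record _≋_ (f g : Series) : Set where
  constructor pointwise
  field at : ∀ n → f n ≡ g n
open _≋_ public

tail : Series → Series
tail f n = f (suc n)

cons : ℤ → Series → Series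
cons c f zero    = c
cons c f (suc n) = f n

const : ℤ → Series
const c = cons c (λ _ → 0ℤ)

infixl 6 _⊕_
infixl 7 _⊛_
infix 8 ⊖_

_⊕_ : Series → Series → Series
(f ⊕ g) n = f n ℤ.+ g n

⊖_ : Series → Series
(⊖ f) n = ℤ.- f n

_⊛_ : Series → Series → Series
(f ⊛ g) zero    = f 0 ℤ.* g 0
(f ⊛ g) (suc n) = f 0 ℤ.* g (suc n) ℤ.+ (tail f ⊛ g) n

X : ℕ → Series
X zero    = const 1ℤ
X (suc n) = cons 0ℤ (X n)

⊛-cong : ∀ {f f′ g g′} → f ≋ f′ → g ≋ g′ → f ⊛ g ≋ f′ ⊛ g′
⊛-cong f≋ g≋ .at zero    = cong₂ ℤ._*_ (f≋ .at 0) (g≋ .at 0)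
⊛-cong f≋ g≋ .at (suc n) = cong₂ ℤ._+_
  (cong₂ ℤ._*_ (f≋ .at 0) (g≋ .at (suc n)))
  (⊛-cong (pointwise λ k → f≋ .at (suc k)) g≋ .at n)

-- The mirror image of the recursion defining `_⊛_`, taking the constant term off the right factor.
-- It makes commutativity a direct induction.
⊛-sucʳ : ∀ f g n → (f ⊛ g) (suc n) ≡ f (suc n) ℤ.* g 0 ℤ.+ (f ⊛ tail g) n
⊛-sucʳ f g zero = ℤ.+-comm (f 0 ℤ.* g 1) (f 1 ℤ.* g 0)
⊛-sucʳ f g (suc n) rewrite ⊛-sucʳ (tail f) g n =
  solve 3 (λ a b c → a :+ (b :+ c) := b :+ (a :+ c)) refl
    (f 0 ℤ.* g (suc (suc n))) (f (suc (suc n)) ℤ.* g 0) ((tail f ⊛ tail g) n)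
  where open ℤSolver.+-*-Solver

⊛-comm : ∀ f g → f ⊛ g ≋ g ⊛ f
⊛-comm f g .at zero    = ℤ.*-comm (f 0) (g 0)
⊛-comm f g .at (suc n) = trans
  (cong₂ ℤ._+_ (ℤ.*-comm (f 0) (g (suc n))) (⊛-comm (tail f) g .at n))
  (sym (⊛-sucʳ g f n))

⊛-distribʳ : ∀ h f g → (f ⊕ g) ⊛ h ≋ f ⊛ h ⊕ g ⊛ h
⊛-distribʳ h f g .at zero = ℤ.*-distribʳ-+ (h 0) (f 0) (g 0)
⊛-distribʳ h f g .at (suc n) rewrite ⊛-distribʳ h (tail f) (tail g) .at n =
  solve 5 (λ a b c d e → (a :+ b) :* c :+ (d :+ e) := a :* c :+ d :+ (b :* c :+ e)) refl
    (f 0) (g 0) (h (suc n)) ((tail f ⊛ h) n) ((tail g ⊛ h) n)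
  where open ℤSolver.+-*-Solver

⊛-scale : ∀ c f g n → ((λ k → c ℤ.* f k) ⊛ g) n ≡ c ℤ.* (f ⊛ g) n
⊛-scale c f g zero = ℤ.*-assoc c (f 0) (g 0)
⊛-scale c f g (suc n) rewrite ⊛-scale c (tail f) g n =
  solve 4 (λ c a b d → c :* a :* b :+ c :* d := c :* (a :* b :+ d)) refl
    c (f 0) (g (suc n)) ((tail f ⊛ g) n)
  where open ℤSolver.+-*-Solver

⊛-assoc : ∀ f g h → (f ⊛ g) ⊛ h ≋ f ⊛ (g ⊛ h)
⊛-assoc f g h .at zero = ℤ.*-assoc (f 0) (g 0) (h 0)
⊛-assoc f g h .at (suc n)
  rewrite ⊛-distribʳ h (λ k → f 0 ℤ.* g (suc k)) (tail f ⊛ g) .at n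
        | ⊛-scale (f 0) (tail g) h n
        | ⊛-assoc (tail f) g h .at n =
  solve 5 (λ a b c d e → a :* b :* c :+ (a :* d :+ e) := a :* (b :* c :+ d) :+ e) refl
    (f 0) (g 0) (h (suc n)) ((tail g ⊛ h) n) ((tail f ⊛ (g ⊛ h)) n)
  where open ℤSolver.+-*-Solver

⊛-zeroˡ : ∀ g n → ((λ _ → 0ℤ) ⊛ g) n ≡ 0ℤ
⊛-zeroˡ g zero    = refl
⊛-zeroˡ g (suc n) rewrite ⊛-zeroˡ g n = refl

const-⊛ : ∀ c g n → (const c ⊛ g) n ≡ c ℤ.* g n
const-⊛ c g zero = refl
const-⊛ c g (suc n) rewrite ⊛-zeroˡ g n = ℤ.+-identityʳ (c ℤ.* g (suc n))

⊛-identityˡ : ∀ g → const 1ℤ ⊛ g ≋ g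
⊛-identityˡ g .at n = trans (const-⊛ 1ℤ g n) (ℤ.*-identityˡ (g n))

X-+ : ∀ m n → X (m ℕ.+ n) ≋ X m ⊛ X n
X-+ zero    n = pointwise λ k → sym (⊛-identityˡ (X n) .at k)
X-+ (suc m) n .at zero    = refl
X-+ (suc m) n .at (suc k) = trans (X-+ m n .at k) (sym (ℤ.+-identityˡ ((X m ⊛ X n) k)))

≋-refl : ∀ {f} → f ≋ f
≋-refl .at n = refl

≋-sym : ∀ {f g} → f ≋ g → g ≋ f
≋-sym e .at n = sym (e .at n)

≋-trans : ∀ {f g h} → f ≋ g → g ≋ h → f ≋ h
≋-trans e e′ .at n = trans (e .at n) (e′ .at n)

seriesRing : CommutativeRing 0ℓ 0ℓ
seriesRing = record
  { Carrier = Series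
  ; _≈_ = _≋_
  ; _+_ = _⊕_
  ; _*_ = _⊛_
  ; -_  = ⊖_
  ; 0#  = λ _ → 0ℤ
  ; 1#  = const 1ℤ
  ; isCommutativeRing = record
    { isRing = record
      { +-isAbelianGroup = record
        { isGroup = record
          { isMonoid = record
            { isSemigroup = record
              { isMagma = record
                { isEquivalence = record { refl = ≋-refl ; sym = ≋-sym ; trans = ≋-trans }
                ; ∙-cong = λ e e′ → pointwise λ n → cong₂ ℤ._+_ (e .at n) (e′ .at n)
                }
              ; assoc = λ f g h → pointwise λ n → ℤ.+-assoc (f n) (g n) (h n)
              }
            ; identity = (λ f → pointwise λ n → ℤ.+-identityˡ (f n))
                       , (λ f → pointwise λ n → ℤ.+-identityʳ (f n))
            }
          ; inverse = (λ f → pointwise λ n → ℤ.+-inverseˡ (f n))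
                    , (λ f → pointwise λ n → ℤ.+-inverseʳ (f n))
          ; ⁻¹-cong = λ e → pointwise λ n → cong ℤ.-_ (e .at n)
          }
        ; comm = λ f g → pointwise λ n → ℤ.+-comm (f n) (g n)
        }
      ; *-cong = ⊛-cong
      ; *-assoc = ⊛-assoc
      ; *-identity = ⊛-identityˡ , λ g → ≋-trans (⊛-comm g (const 1ℤ)) (⊛-identityˡ g)
      ; distrib = (λ f g h → ≋-trans (⊛-comm f (g ⊕ h))
                    (≋-trans (⊛-distribʳ f g h)
                      (pointwise λ n → cong₂ ℤ._+_ (⊛-comm g f .at n) (⊛-comm h f .at n))))
                , ⊛-distribʳ
      }
    ; *-comm = ⊛-comm
    }
  }

constHom : ℤ.+-*-rawRing -Raw-AlmostCommutative⟶ fromCommutativeRing seriesRing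
constHom = record
  { ⟦_⟧    = const
  ; +-homo = λ a b → pointwise λ { zero → refl ; (suc n) → refl }
  ; *-homo = λ a b → pointwise λ
      { zero → refl ; (suc n) → sym (trans (const-⊛ a (const b) (suc n)) (ℤ.*-zeroʳ a)) }
  ; -‿homo = λ a → pointwise λ { zero → refl ; (suc n) → refl }
  ; 0-homo = pointwise λ { zero → refl ; (suc n) → refl }
  ; 1-homo = ≋-refl
  }

-- Compare constant coefficients first; h then starts with 0 and its tail is again annihilated.
unit-cancel-zero : ∀ c h → c 0 ≡ 1ℤ → (∀ n → (c ⊛ h) n ≡ 0ℤ) → ∀ n → h n ≡ 0ℤ
unit-cancel-zero c h c0 ch≡0 = λ { zero → h0 ; (suc n) → unit-cancel-zero c (tail h) c0 cth≡0 n }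
  where
  h0 : h 0 ≡ 0ℤ
  h0 = trans (sym (ℤ.*-identityˡ (h 0))) (trans (cong (ℤ._* h 0) (sym c0)) (ch≡0 0))
  cth≡0 : ∀ n → (c ⊛ tail h) n ≡ 0ℤ
  cth≡0 n = begin
    (c ⊛ tail h) n                          ≡⟨ ℤ.+-identityˡ _ ⟨
    0ℤ ℤ.+ (c ⊛ tail h) n                   ≡⟨ cong (ℤ._+ (c ⊛ tail h) n) (ℤ.*-zeroʳ (c (suc n))) ⟨
    c (suc n) ℤ.* 0ℤ ℤ.+ (c ⊛ tail h) n     ≡⟨ cong (λ z → c (suc n) ℤ.* z ℤ.+ (c ⊛ tail h) n) h0 ⟨
    c (suc n) ℤ.* h 0 ℤ.+ (c ⊛ tail h) n    ≡⟨ ⊛-sucʳ c h n ⟨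
    (c ⊛ h) (suc n)                         ≡⟨ ch≡0 (suc n) ⟩
    0ℤ ∎
    where open ≡-Reasoning

module 𝕊 = CommutativeRing seriesRing
module ≋-Reasoning = Relation.Binary.Reasoning.Setoid 𝕊.setoid
open RingIdentities seriesRing constHom
open Solver using (solve; _:=_; _:+_; _:*_; _:-_; :-_)

-- Long division

-- `difference` and `division` are accessible copies of the private `subL` and `longDiv`.
difference : List ℤ → List ℤ → List ℤ
difference xs       []       = xs
difference []       (y ∷ ys) = map ℤ.-_ (y ∷ ys)
difference (x ∷ xs) (y ∷ ys) = (x ℤ.- y) ∷ difference xs ys

division : ℕ → List ℤ → List ℤ → List ℤ
division zero    ds r       = []
division (suc k) ds []      = []
division (suc k) ds (c ∷ r) = c ∷ division k ds (difference r (map (c ℤ.*_) ds))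

difference-unique : (s : ℤ → List ℤ → List ℤ → List ℤ) →
  (∀ c xs → s c [] xs ≡ xs) →
  (∀ c y ys → s c (y ∷ ys) [] ≡ map ℤ.-_ (map (c ℤ.*_) (y ∷ ys))) →
  (∀ c y ys x xs → s c (y ∷ ys) (x ∷ xs) ≡ (x ℤ.- c ℤ.* y) ∷ s c ys xs) →
  ∀ c ys xs → s c ys xs ≡ difference xs (map (c ℤ.*_) ys)
difference-unique s e₁ e₂ e₃ c []       xs       = e₁ c xs
difference-unique s e₁ e₂ e₃ c (y ∷ ys) []       = e₂ c y ys
difference-unique s e₁ e₂ e₃ c (y ∷ ys) (x ∷ xs) =
  trans (e₃ c y ys x xs) (cong (_ ∷_) (difference-unique s e₁ e₂ e₃ c ys xs))

-- The recursion equations determine the function, so of `f` and `s` only their computation rules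
-- are needed. The accumulator is that of `reverse`: each division step pushes one quotient
-- coefficient onto it.
division-unique : (f : List ℤ → ℕ → List ℤ → List ℤ → List ℤ) (s : ℤ → List ℤ → List ℤ → List ℤ) →
  (∀ acc ds r → f acc zero ds r ≡ acc) →
  (∀ acc k ds → f acc (suc k) ds [] ≡ acc) →
  (∀ acc k ds c r → f acc (suc k) ds (c ∷ r) ≡ f (c ∷ acc) k ds (s c ds r)) →
  (∀ c ds r → s c ds r ≡ difference r (map (c ℤ.*_) ds)) →
  ∀ acc k ds r → f acc k ds r ≡ foldl (flip _∷_) acc (division k ds r)
division-unique f s e₁ e₂ e₃ eₛ acc zero    ds r       = e₁ acc ds r
division-unique f s e₁ e₂ e₃ eₛ acc (suc k) ds []      = e₂ acc k ds
division-unique f s e₁ e₂ e₃ eₛ acc (suc k) ds (c ∷ r) = trans (e₃ acc k ds c r)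
  (trans (division-unique f s e₁ e₂ e₃ eₛ (c ∷ acc) k ds _)
    (cong (λ r → foldl (flip _∷_) (c ∷ acc) (division k ds r)) (eₛ c ds r)))

-- subL and longDiv are private to Defs.  Once every argument of the call of longDiv in divMonic,
-- and the accumulator of the outer reverse, is a variable, pattern unification finds the two holes.
mutual

  private
    reverse-longDiv : List ℤ → ℕ → List ℤ → List ℤ → List ℤ
    reverse-longDiv = _

    scaled-subL : ℤ → List ℤ → List ℤ → List ℤ
    scaled-subL = _

  divMonic-division : ∀ p d {c ds} → reverse (normalize d) ≡ c ∷ ds →
    let p′ = reverse (normalize p) in
    divMonic p d ≡ reverse (division (length p′ ∸ length ds) ds p′)
  divMonic-division p d {c} {ds} eq with reverse (normalize d) | eq
  ... | .(c ∷ ds) | refl with reverse (normalize p)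
  ... | p′ with length p′ ∸ length ds
  ... | n with List.[] {A = ℤ}
  ... | acc = division-unique reverse-longDiv scaled-subL
    (λ _ _ _ → refl) (λ _ _ _ → refl) (λ _ _ _ _ _ → refl)
    (difference-unique scaled-subL (λ _ _ → refl) (λ _ _ _ → refl) (λ _ _ _ _ _ → refl)) acc n ds p′

0# : Series
0# _ = 0ℤ

coeff-+P : ∀ p q → coeff (p +P q) ≋ coeff p ⊕ coeff q
coeff-+P []      q       = pointwise λ k → sym (ℤ.+-identityˡ (coeff q k))
coeff-+P (a ∷ p) []      = pointwise λ k → sym (ℤ.+-identityʳ (coeff (a ∷ p) k))
coeff-+P (a ∷ p) (b ∷ q) = pointwise λ { zero → refl ; (suc k) → coeff-+P p q .at k }

coeff-map-* : ∀ a q k → coeff (map (a ℤ.*_) q) k ≡ a ℤ.* coeff q k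
coeff-map-* a []      k       = sym (ℤ.*-zeroʳ a)
coeff-map-* a (b ∷ q) zero    = refl
coeff-map-* a (b ∷ q) (suc k) = coeff-map-* a q k

coeff-*P : ∀ p q → coeff (p *P q) ≋ coeff p ⊛ coeff q
coeff-*P []      q .at k = sym (⊛-zeroˡ (coeff q) k)
coeff-*P (a ∷ p) q .at k = trans (coeff-+P (map (a ℤ.*_) q) (0ℤ ∷ p *P q) .at k) (step k)
  where
  step : ∀ k → coeff (map (a ℤ.*_) q) k ℤ.+ coeff (0ℤ ∷ p *P q) k ≡ (coeff (a ∷ p) ⊛ coeff q) k
  step zero    = trans (ℤ.+-identityʳ _) (coeff-map-* a q 0)
  step (suc k) = cong₂ ℤ._+_ (coeff-map-* a q (suc k)) (coeff-*P p q .at k)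

coeff-∷ʳ : ∀ l a → coeff (l ∷ʳ a) ≋ coeff l ⊕ const a ⊛ X (length l)
coeff-∷ʳ []      a .at k = trans (helper k) (sym (trans (ℤ.+-identityˡ _) (const-⊛ a (X 0) k)))
  where
  helper : ∀ k → coeff (a ∷ []) k ≡ a ℤ.* X 0 k
  helper zero    = sym (ℤ.*-identityʳ a)
  helper (suc k) = sym (ℤ.*-zeroʳ a)
coeff-∷ʳ (b ∷ l) a .at zero = sym (trans (cong (λ z → b ℤ.+ z) (ℤ.*-zeroʳ a)) (ℤ.+-identityʳ b))
coeff-∷ʳ (b ∷ l) a .at (suc k) = trans (coeff-∷ʳ l a .at k)
  (cong (λ z → coeff l k ℤ.+ z) (trans (const-⊛ a (X (length l)) k) (sym (const-⊛ a (X (suc (length l))) (suc k)))))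

coeff-reverse-∷ : ∀ a l → coeff (reverse (a ∷ l)) ≋ coeff (reverse l) ⊕ const a ⊛ X (length l)
coeff-reverse-∷ a l rewrite List.unfold-reverse a l =
  subst (λ n → coeff (reverse l ∷ʳ a) ≋ coeff (reverse l) ⊕ const a ⊛ X n) (List.length-reverse l)
    (coeff-∷ʳ (reverse l) a)

+P-identityʳ : ∀ p → p +P [] ≡ p
+P-identityʳ []      = refl
+P-identityʳ (a ∷ p) = refl

length-+P : ∀ p q → length p ≤ length q → length (p +P q) ≡ length q
length-+P []      q       _       = refl
length-+P (a ∷ p) (b ∷ q) (s≤s h) = cong suc (length-+P p q h)

length-*P : ∀ a p b q → length ((a ∷ p) *P (b ∷ q)) ≡ length p ℕ.+ length (b ∷ q)
length-*P a []      b q = cong suc (trans (cong length (+P-identityʳ (map (a ℤ.*_) q))) (List.length-map _ q))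
length-*P a (c ∷ p) b q = trans
  (length-+P (map (a ℤ.*_) (b ∷ q)) (0ℤ ∷ r)
    (subst₂ _≤_ (sym (List.length-map (a ℤ.*_) (b ∷ q))) (sym eq) (ℕ.m≤n+m _ (suc (length p)))))
  eq
  where
  r = (c ∷ p) *P (b ∷ q)
  eq : suc (length r) ≡ suc (length p) ℕ.+ length (b ∷ q)
  eq = cong suc (length-*P c p b q)

-- `_+P_` aligns lists at their heads. On big-endian lists these are the leading coefficients, so
-- the shorter summand is raised by the difference `m` of the lengths.
coeff-reverse-+P : ∀ m p q → m ℕ.+ length p ≡ length q →
  coeff (reverse (p +P q)) ≋ X m ⊛ coeff (reverse p) ⊕ coeff (reverse q)
coeff-reverse-+P m [] q eq = begin
  coeff (reverse q)                ≈⟨ 𝕊.+-identityˡ (coeff (reverse q)) ⟨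
  0# ⊕ coeff (reverse q)           ≈⟨ 𝕊.+-congʳ {coeff (reverse q)} (𝕊.zeroʳ (X m)) ⟨
  X m ⊛ 0# ⊕ coeff (reverse q)     ∎
  where open ≋-Reasoning
coeff-reverse-+P m (a ∷ p) [] eq with () ← trans (sym (ℕ.+-suc m (length p))) eq
coeff-reverse-+P m (a ∷ p) (b ∷ q) eq = begin
  coeff (reverse ((a ℤ.+ b) ∷ (p +P q)))
    ≈⟨ coeff-reverse-∷ (a ℤ.+ b) (p +P q) ⟩
  coeff (reverse (p +P q)) ⊕ const (a ℤ.+ b) ⊛ X (length (p +P q))
    ≈⟨ 𝕊.+-cong (coeff-reverse-+P m p q eq′) (𝕊.*-cong (constHom-+ a b) (𝕊.reflexive (cong X length≡))) ⟩
  X m ⊛ coeff (reverse p) ⊕ coeff (reverse q) ⊕ (const a ⊕ const b) ⊛ X (m ℕ.+ length p)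
    ≈⟨ 𝕊.+-congˡ {X m ⊛ coeff (reverse p) ⊕ coeff (reverse q)} (𝕊.*-congˡ {const a ⊕ const b} (X-+ m (length p))) ⟩
  X m ⊛ coeff (reverse p) ⊕ coeff (reverse q) ⊕ (const a ⊕ const b) ⊛ (X m ⊛ X (length p))
    ≈⟨ solve 6 (λ x u v a b y → x :* u :+ v :+ (a :+ b) :* (x :* y) := x :* (u :+ a :* y) :+ (v :+ b :* (x :* y))) 𝕊.refl
         (X m) (coeff (reverse p)) (coeff (reverse q)) (const a) (const b) (X (length p)) ⟩
  X m ⊛ (coeff (reverse p) ⊕ const a ⊛ X (length p)) ⊕ (coeff (reverse q) ⊕ const b ⊛ (X m ⊛ X (length p)))
    ≈⟨ 𝕊.+-cong (𝕊.*-congˡ {X m} (coeff-reverse-∷ a p)) (𝕊.trans (coeff-reverse-∷ b q)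
         (𝕊.+-congˡ {coeff (reverse q)} (𝕊.*-congˡ {const b}
           (𝕊.trans (𝕊.reflexive (cong X (sym eq′))) (X-+ m (length p)))))) ⟨
  X m ⊛ coeff (reverse (a ∷ p)) ⊕ coeff (reverse (b ∷ q)) ∎
  where
  open ≋-Reasoning
  eq′ : m ℕ.+ length p ≡ length q
  eq′ = ℕ.suc-injective (trans (sym (ℕ.+-suc m (length p))) eq)
  length≡ : length (p +P q) ≡ m ℕ.+ length p
  length≡ = trans (length-+P p q (subst (length p ≤_) eq′ (ℕ.m≤n+m _ m))) (sym eq′)
  constHom-+ : ∀ a b → const (a ℤ.+ b) ≋ const a ⊕ const b
  constHom-+ a b .at zero    = refl
  constHom-+ a b .at (suc n) = refl

coeff-reverse-map-* : ∀ a q → coeff (reverse (map (a ℤ.*_) q)) ≋ const a ⊛ coeff (reverse q)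
coeff-reverse-map-* a q .at k rewrite sym (List.reverse-map (a ℤ.*_) q) =
  trans (coeff-map-* a (reverse q) k) (sym (const-⊛ a (coeff (reverse q)) k))

-- Long division runs on big-endian lists, and this lets the same `_*P_` describe products there.
-- Reversal respects products because the length of a product of nonempty lists is exactly one less
-- than the sum of the lengths, even if coefficients vanish.
coeff-reverse-*P : ∀ a p b q →
  coeff (reverse ((a ∷ p) *P (b ∷ q))) ≋ coeff (reverse (a ∷ p)) ⊛ coeff (reverse (b ∷ q))
coeff-reverse-*P a [] b q = begin
  coeff (reverse ((a ∷ []) *P (b ∷ q)))
    ≡⟨ cong₂ (λ z l → coeff (reverse (z ∷ l))) (ℤ.+-identityʳ (a ℤ.* b)) (+P-identityʳ (map (a ℤ.*_) q)) ⟩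
  coeff (reverse (map (a ℤ.*_) (b ∷ q)))
    ≈⟨ coeff-reverse-map-* a (b ∷ q) ⟩
  const a ⊛ coeff (reverse (b ∷ q))
    ≈⟨ 𝕊.*-congʳ {coeff (reverse (b ∷ q))} (pointwise λ { zero → refl ; (suc _) → refl }) ⟩
  coeff (a ∷ []) ⊛ coeff (reverse (b ∷ q)) ∎
  where open ≋-Reasoning
coeff-reverse-*P a (c ∷ p) b q = begin
  coeff (reverse (map (a ℤ.*_) (b ∷ q) +P (0ℤ ∷ r)))
    ≈⟨ coeff-reverse-+P (suc (length p)) (map (a ℤ.*_) (b ∷ q)) (0ℤ ∷ r)
         (trans (cong (suc (length p) ℕ.+_) (List.length-map _ (b ∷ q))) (cong suc (sym (length-*P c p b q)))) ⟩
  X (suc (length p)) ⊛ coeff (reverse (map (a ℤ.*_) (b ∷ q))) ⊕ coeff (reverse (0ℤ ∷ r))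
    ≈⟨ 𝕊.+-cong (𝕊.*-congˡ {X (suc (length p))} (coeff-reverse-map-* a (b ∷ q))) reverse-0∷r ⟩
  X (suc (length p)) ⊛ (const a ⊛ Q) ⊕ coeff (reverse (c ∷ p)) ⊛ Q
    ≈⟨ solve 4 (λ x a Q P → x :* (a :* Q) :+ P :* Q := (P :+ a :* x) :* Q) 𝕊.refl
         (X (suc (length p))) (const a) Q (coeff (reverse (c ∷ p))) ⟩
  (coeff (reverse (c ∷ p)) ⊕ const a ⊛ X (suc (length p))) ⊛ Q
    ≈⟨ 𝕊.*-congʳ {Q} (coeff-reverse-∷ a (c ∷ p)) ⟨
  coeff (reverse (a ∷ c ∷ p)) ⊛ Q ∎
  where
  open ≋-Reasoning
  r = (c ∷ p) *P (b ∷ q)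
  Q = coeff (reverse (b ∷ q))
  reverse-0∷r : coeff (reverse (0ℤ ∷ r)) ≋ coeff (reverse (c ∷ p)) ⊛ Q
  reverse-0∷r = begin
    coeff (reverse (0ℤ ∷ r))                          ≈⟨ coeff-reverse-∷ 0ℤ r ⟩
    coeff (reverse r) ⊕ const 0ℤ ⊛ X (length r)       ≈⟨ solve 2 (λ u x → u :+ Solver.con 0ℤ :* x := u) 𝕊.refl (coeff (reverse r)) (X (length r)) ⟩
    coeff (reverse r)                                 ≈⟨ coeff-reverse-*P c p b q ⟩
    coeff (reverse (c ∷ p)) ⊛ Q                       ∎

zeros : ∀ l → (∀ k → coeff l k ≡ 0ℤ) → ∃ λ m → l ≡ replicate m 0ℤ
zeros []      h = 0 , refl
zeros (a ∷ l) h with zeros l (h ∘ suc)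
... | m , refl = suc m , cong (_∷ _) (h 0)

nonzero : ∀ l → ¬ (coeff [] ≋ coeff (l ∷ʳ 1ℤ))
nonzero []      e with () ← e .at 0
nonzero (a ∷ l) e = nonzero l (pointwise λ k → e .at (suc k))

trailing-zeros : ∀ p l → coeff p ≋ coeff (l ∷ʳ 1ℤ) → ∃ λ m → p ≡ (l ∷ʳ 1ℤ) ++ replicate m 0ℤ
trailing-zeros []      l       e = ⊥-elim (nonzero l e)
trailing-zeros (b ∷ p) []      e with zeros p (λ k → e .at (suc k)) | e .at 0
... | m , refl | refl = m , refl
trailing-zeros (b ∷ p) (a ∷ l) e with trailing-zeros p l (pointwise λ k → e .at (suc k)) | e .at 0
... | m , refl | refl = m , refl

-- A list with the coefficients of a monic polynomial can differ from the canonical list only by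
-- trailing zeros. `normalize` strips these, and the leading 1 stops `dropWhile`.
reverse-normalize : ∀ p gs → coeff p ≋ coeff (reverse (1ℤ ∷ gs)) → reverse (normalize p) ≡ 1ℤ ∷ gs
reverse-normalize p gs e with trailing-zeros p (reverse gs) (subst (λ l → coeff p ≋ coeff l) (List.unfold-reverse 1ℤ gs) e)
... | m , refl = begin
  reverse (normalize ((reverse gs ∷ʳ 1ℤ) ++ replicate m 0ℤ))
    ≡⟨ List.reverse-involutive _ ⟩
  dropWhile (ℤ._≟ 0ℤ) (reverse ((reverse gs ∷ʳ 1ℤ) ++ replicate m 0ℤ))
    ≡⟨ cong (dropWhile (ℤ._≟ 0ℤ)) (trans (List.reverse-++ (reverse gs ∷ʳ 1ℤ) (replicate m 0ℤ))
         (cong₂ _++_ (reverse-zeros m) (trans (List.reverse-++ (reverse gs) (1ℤ ∷ [])) (cong (1ℤ ∷_) (List.reverse-involutive gs))))) ⟩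
  dropWhile (ℤ._≟ 0ℤ) (replicate m 0ℤ ++ 1ℤ ∷ gs)
    ≡⟨ drop-zeros m ⟩
  1ℤ ∷ gs ∎
  where
  open ≡-Reasoning
  snoc-zeros : ∀ m → replicate m 0ℤ ∷ʳ 0ℤ ≡ 0ℤ ∷ replicate m 0ℤ
  snoc-zeros zero    = refl
  snoc-zeros (suc m) = cong (0ℤ ∷_) (snoc-zeros m)
  reverse-zeros : ∀ m → reverse (replicate m 0ℤ) ≡ replicate m 0ℤ
  reverse-zeros zero    = refl
  reverse-zeros (suc m) = trans (List.unfold-reverse 0ℤ (replicate m 0ℤ))
    (trans (cong (_∷ʳ 0ℤ) (reverse-zeros m)) (snoc-zeros m))
  drop-zeros : ∀ m → dropWhile (ℤ._≟ 0ℤ) (replicate m 0ℤ ++ 1ℤ ∷ gs) ≡ 1ℤ ∷ gs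
  drop-zeros zero    = refl
  drop-zeros (suc m) = drop-zeros m

difference-+P : ∀ xs ys → length xs ≤ length ys → difference (xs +P ys) xs ≡ ys
difference-+P []       ys       _       = refl
difference-+P (x ∷ xs) (y ∷ ys) (s≤s h) = cong₂ _∷_
  (ℤ-Solver.solve 2 (λ x y → x ℤ-Solver.:+ y ℤ-Solver.:- x ℤ-Solver.:= y) refl x y) (difference-+P xs ys h)
  where
  module ℤ-Solver = ℤSolver.+-*-Solver

-- The big-endian product is `g` times the divisor plus the remaining product shifted by one place.
-- As the divisor is monic, the head of the dividend is `g` itself, and subtracting `g` times `ds`
-- leaves exactly the product of the remaining quotient with the divisor.
division-*P : ∀ gs ds → division (length gs) ds (gs *P (1ℤ ∷ ds)) ≡ gs
division-*P []           ds = refl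
division-*P (g ∷ [])     ds = cong (_∷ []) (trans (ℤ.+-identityʳ _) (ℤ.*-identityʳ g))
division-*P (g ∷ h ∷ gs) ds = cong₂ _∷_ (trans (ℤ.+-identityʳ _) (ℤ.*-identityʳ g))
  (trans (cong (division (suc (length gs)) ds)
      (trans (cong (λ c → difference (map (g ℤ.*_) ds +P rest) (map (c ℤ.*_) ds)) (trans (ℤ.+-identityʳ _) (ℤ.*-identityʳ g)))
        (difference-+P (map (g ℤ.*_) ds) rest
        (subst₂ _≤_ (sym (List.length-map _ ds)) (sym (length-*P h gs 1ℤ ds))
          (ℕ.≤-trans (ℕ.n≤1+n _) (ℕ.m≤n+m _ (length gs)))))))
    (division-*P (h ∷ gs) ds))
  where
  rest = (h ∷ gs) *P (1ℤ ∷ ds)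

divMonic-exact : ∀ p d gs ds → coeff d ≋ coeff (reverse (1ℤ ∷ ds)) →
  coeff p ≋ coeff (reverse (1ℤ ∷ gs)) ⊛ coeff d → divMonic p d ≡ reverse (1ℤ ∷ gs)
divMonic-exact p d gs ds ed ep = begin
  divMonic p d
    ≡⟨ divMonic-division p d (reverse-normalize d ds ed) ⟩
  reverse (division (length (reverse (normalize p)) ∸ length ds) ds (reverse (normalize p)))
    ≡⟨ cong (λ l → reverse (division (length l ∸ length ds) ds l)) (reverse-normalize p _ (≋-trans ep
         (≋-trans (𝕊.*-congˡ {coeff (reverse (1ℤ ∷ gs))} ed) (≋-sym (coeff-reverse-*P 1ℤ gs 1ℤ ds))))) ⟩
  reverse (division (length fg ∸ length ds) ds fg)
    ≡⟨ cong (λ n → reverse (division n ds fg)) length-quotient ⟩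
  reverse (division (suc (length gs)) ds fg)
    ≡⟨ cong reverse (division-*P (1ℤ ∷ gs) ds) ⟩
  reverse (1ℤ ∷ gs) ∎
  where
  open ≡-Reasoning
  fg = (1ℤ ∷ gs) *P (1ℤ ∷ ds)
  length-quotient : length fg ∸ length ds ≡ suc (length gs)
  length-quotient = trans (cong (_∸ length ds) (trans (length-*P 1ℤ gs 1ℤ ds) (ℕ.+-suc (length gs) (length ds))))
    (ℕ.m+n∸n≡m (suc (length gs)) (length ds))

-- Monic polynomials among the power series

Bounded : ℕ → Series → Set
Bounded n f = ∀ k → n ≤ k → f k ≡ 0ℤ

Monic : ℕ → Series → Set
Monic n f = f n ≡ 1ℤ × Bounded (suc n) f

Monic-cong : ∀ {n f g} → f ≋ g → Monic n f → Monic n g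
Monic-cong e (lead , top) = trans (sym (e .at _)) lead , λ k n<k → trans (sym (e .at k)) (top k n<k)

const-Bounded-⊛ : ∀ f g → Bounded 1 f → f ⊛ g ≋ const (f 0) ⊛ g
const-Bounded-⊛ f g top = ⊛-cong (pointwise λ { zero → refl ; (suc k) → top (suc k) (s≤s z≤n) }) ≋-refl

Monic-⊛ : ∀ m n f g → Monic m f → Monic n g → Monic (m ℕ.+ n) (f ⊛ g)
Monic-⊛ zero n f g (lead , top) Mg = Monic-cong (≋-sym (≋-trans (const-Bounded-⊛ f g top)
  (subst (λ c → const c ⊛ g ≋ g) (sym lead) (⊛-identityˡ g)))) Mg
Monic-⊛ (suc m) n f g (lead , top) Mg@(_ , topg) with Monic-⊛ m n (tail f) g (lead , λ k m<k → top (suc k) (s≤s m<k)) Mg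
... | lead′ , top′ =
  trans (cong₂ ℤ._+_ (gap (m ℕ.+ n) (s≤s (ℕ.m≤n+m n m))) lead′) refl ,
  λ { (suc k) (s≤s h) → trans (cong₂ ℤ._+_ (gap k (s≤s (ℕ.≤-trans (ℕ.m≤n+m n (suc m)) h))) (top′ k h)) refl }
  where
  gap : ∀ k → n < suc k → f 0 ℤ.* g (suc k) ≡ 0ℤ
  gap k n<k = trans (cong (f 0 ℤ.*_) (topg (suc k) n<k)) (ℤ.*-zeroʳ (f 0))

Monic-1 : Monic 0 (const 1ℤ)
Monic-1 = refl , λ { (suc k) _ → refl }

monicTail : ℕ → Series → List ℤ
monicTail n f = reverse (applyUpTo f n)

coeff-applyUpTo-∷ʳ : ∀ n f → Monic n f → coeff (applyUpTo f n ∷ʳ 1ℤ) ≋ f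
coeff-applyUpTo-∷ʳ zero f (lead , top) =
  pointwise λ { zero → sym lead ; (suc k) → sym (top (suc k) (s≤s z≤n)) }
coeff-applyUpTo-∷ʳ (suc n) f (lead , top) = pointwise λ
  { zero    → refl
  ; (suc k) → coeff-applyUpTo-∷ʳ n (tail f) (lead , λ j n<j → top (suc j) (s≤s n<j)) .at k }

coeff-monicTail : ∀ n f → Monic n f → coeff (reverse (1ℤ ∷ monicTail n f)) ≋ f
coeff-monicTail n f Mf rewrite List.unfold-reverse 1ℤ (monicTail n f)
  | List.reverse-involutive (applyUpTo f n) = coeff-applyUpTo-∷ʳ n f Mf

-- The interface to long division: to evaluate `divMonic`, it now suffices to know a factorization
-- of series and the monicity of both factors.
divMonic-series : ∀ {m n f g} p d → Monic m f → Monic n g →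
  coeff d ≋ g → coeff p ≋ f ⊛ g → coeff (divMonic p d) ≋ f
divMonic-series {m} {n} {f} {g} p d Mf Mg ed ep = ≋-trans
  (𝕊.reflexive (cong coeff (divMonic-exact p d (monicTail m f) (monicTail n g)
    (≋-trans ed (≋-sym (coeff-monicTail n g Mg)))
    (≋-trans ep (⊛-cong (≋-sym (coeff-monicTail m f Mf)) (≋-sym ed))))))
  (coeff-monicTail m f Mf)

X-diag : ∀ n → X n n ≡ 1ℤ
X-diag zero    = refl
X-diag (suc n) = X-diag n

X-Bounded : ∀ n → Bounded (suc n) (X n)
X-Bounded zero    (suc k) _       = refl
X-Bounded (suc n) (suc k) (s≤s h) = X-Bounded n k h

Bounded-⊕ : ∀ {n f g} → Bounded n f → Bounded n g → Bounded n (f ⊕ g)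
Bounded-⊕ bf bg k h = cong₂ ℤ._+_ (bf k h) (bg k h)

Bounded-⊖ : ∀ {n f} → Bounded n f → Bounded n (⊖ f)
Bounded-⊖ bf k h = cong ℤ.-_ (bf k h)

Bounded-Σ : ∀ {N} n f → (∀ i → i < n → Bounded N (f i)) → Bounded N (Σ n f)
Bounded-Σ zero    f b k h = refl
Bounded-Σ (suc n) f b = Bounded-⊕ (b 0 (s≤s z≤n)) (Bounded-Σ n (f ∘ suc) λ i i<n → b (suc i) (s≤s i<n))

Monic-⊕X : ∀ {n f} → Bounded n f → Monic n (f ⊕ X n)
Monic-⊕X {n} b = cong₂ ℤ._+_ (b n ℕ.≤-refl) (X-diag n) ,
  λ k n<k → cong₂ ℤ._+_ (b k (ℕ.<⇒≤ n<k)) (X-Bounded n k n<k)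

X-^ : ∀ n → X 1 ^ n ≋ X n
X-^ zero    = ≋-refl
X-^ (suc n) = ≋-trans (⊛-cong (≋-refl {X 1}) (X-^ n)) (≋-sym (X-+ 1 n))

-- The series of `x^n - 1`. For `n ≥ 1` its constant term is -1, so products of an even number of
-- these have constant term 1 and can be cancelled.
U : ℕ → Series
U n = X n ⊕ ⊖ const 1ℤ

U-^ : ∀ n → X 1 ^ n ⊕ ⊖ const 1ℤ ≋ U n
U-^ n = 𝕊.+-congʳ {⊖ const 1ℤ} (X-^ n)

Monic-U : ∀ n → Monic (suc n) (U (suc n))
Monic-U n = trans (ℤ.+-identityʳ _) (X-diag n) , λ { (suc k) (s≤s h) → trans (ℤ.+-identityʳ _) (X-Bounded n k h) }

coeff-xpow-1 : ∀ n → coeff (xpow-1 n) ≋ U n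
coeff-xpow-1 n = ≋-trans (coeff-+P (xpow n) _) (pointwise λ k → cong₂ ℤ._+_ (coeff-xpow n k) (coeff-1 k))
  where
  coeff-xpow : ∀ n k → coeff (xpow n) k ≡ X n k
  coeff-xpow zero    zero    = refl
  coeff-xpow zero    (suc k) = refl
  coeff-xpow (suc n) zero    = refl
  coeff-xpow (suc n) (suc k) = coeff-xpow n k
  coeff-1 : ∀ k → coeff (-[1+ 0 ] ∷ []) k ≡ (⊖ const 1ℤ) k
  coeff-1 zero    = refl
  coeff-1 (suc k) = refl

unit-cancel : ∀ c {f g} → c 0 ≡ 1ℤ → c ⊛ f ≋ c ⊛ g → f ≋ g
unit-cancel c {f} {g} c0 e = pointwise λ k → ℤ.i-j≡0⇒i≡j (f k) (g k)
  (unit-cancel-zero c (f ⊕ ⊖ g) c0 annihilated k)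
  where
  annihilated : ∀ k → (c ⊛ (f ⊕ ⊖ g)) k ≡ 0ℤ
  annihilated k = trans
    (solve 3 (λ c f g → c :* (f :- g) := c :* f :- c :* g) 𝕊.refl c f g .at k)
    (ℤ.i≡j⇒i-j≡0 {(c ⊛ f) k} (e .at k))

prodP-↭ : ∀ {ps qs} → ps ↭ qs → coeff (prodP ps) ≋ coeff (prodP qs)
prodP-↭ ↭.refl = ≋-refl
prodP-↭ (↭.prep {ps} {qs} p e) = prodP-∷ p ps qs (prodP-↭ e)
  where
  prodP-∷ : ∀ p ps qs → coeff (prodP ps) ≋ coeff (prodP qs) → coeff (prodP (p ∷ ps)) ≋ coeff (prodP (p ∷ qs))
  prodP-∷ p ps qs e = ≋-trans (coeff-*P p (prodP ps)) (≋-trans (⊛-cong (≋-refl {coeff p}) e) (≋-sym (coeff-*P p (prodP qs))))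
prodP-↭ (↭.swap {ps} {qs} p q e) = begin
  coeff (p *P (q *P prodP ps))
    ≈⟨ ≋-trans (coeff-*P p _) (⊛-cong (≋-refl {coeff p}) (coeff-*P q (prodP ps))) ⟩
  coeff p ⊛ (coeff q ⊛ coeff (prodP ps))
    ≈⟨ 𝕊.*-congˡ {coeff p} (𝕊.*-congˡ {coeff q} (prodP-↭ e)) ⟩
  coeff p ⊛ (coeff q ⊛ coeff (prodP qs))
    ≈⟨ solve 3 (λ p q s → p :* (q :* s) := q :* (p :* s)) 𝕊.refl (coeff p) (coeff q) (coeff (prodP qs)) ⟩
  coeff q ⊛ (coeff p ⊛ coeff (prodP qs))
    ≈⟨ ≋-trans (coeff-*P q _) (⊛-cong (≋-refl {coeff q}) (coeff-*P p (prodP qs))) ⟨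
  coeff (q *P (p *P prodP qs)) ∎
  where open ≋-Reasoning
prodP-↭ (↭.trans e e′) = ≋-trans (prodP-↭ e) (prodP-↭ e′)

-- Cyclotomic polynomials with at most three prime factors

prodS : List Series → Series
prodS = foldr _⊛_ (const 1ℤ)

coeff-prodP : ∀ {ps fs} → Pointwise (λ p f → coeff p ≋ f) ps fs → coeff (prodP ps) ≋ prodS fs
coeff-prodP [] = pointwise λ { zero → refl ; (suc k) → refl }
coeff-prodP {p ∷ ps} (e ∷ es) = ≋-trans (coeff-*P p (prodP ps)) (⊛-cong e (coeff-prodP es))

Monic-prodS : ∀ {fs} → All (λ f → ∃ λ n → Monic n f) fs → ∃ λ n → Monic n (prodS fs)
Monic-prodS [] = 0 , Monic-1
Monic-prodS ((m , Mf) ∷ Ms) with Monic-prodS Ms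
... | n , Mfs = m + n , Monic-⊛ m n _ _ Mf Mfs

-- One step of the recursion, with the quotient given in advance: a monic candidate `h` is verified
-- by multiplication, and the exactness of the division does the rest.
cycloF-suc : ∀ {m ds h fs} f n → properDivisors n ↭ ds →
  Pointwise (λ p f → coeff p ≋ f) (map (cycloF f) ds) fs →
  All (λ f → ∃ λ n → Monic n f) fs → Monic m h → U n ≋ h ⊛ prodS fs →
  coeff (cycloF (suc f) n) ≋ h
cycloF-suc f n ds↭ es Ms Mh e with Monic-prodS Ms
... | _ , Mg = divMonic-series (xpow-1 n) (prodP (map (cycloF f) (properDivisors n))) Mh Mg
  (≋-trans (prodP-↭ (↭-map⁺ (cycloF f) ds↭)) (coeff-prodP es))
  (≋-trans (coeff-xpow-1 n) e)

-- For prime n + 1 this is the cyclotomic polynomial Φ_{n+1}.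
ψ : ℕ → Series
ψ n = Σ n (X 1 ^_) ⊕ X 1 ^ n

ψ-spec : ∀ n → U 1 ⊛ ψ n ≋ U (suc n)
ψ-spec n = begin
  U 1 ⊛ (Σ n (X 1 ^_) ⊕ X 1 ^ n)
    ≈⟨ 𝕊.distribˡ (U 1) (Σ n (X 1 ^_)) (X 1 ^ n) ⟩
  U 1 ⊛ Σ n (X 1 ^_) ⊕ U 1 ⊛ X 1 ^ n
    ≈⟨ 𝕊.+-congʳ {U 1 ⊛ X 1 ^ n} (geometric n (X 1)) ⟩
  X 1 ^ n ⊕ ⊖ const 1ℤ ⊕ U 1 ⊛ X 1 ^ n
    ≈⟨ solve 2 (λ x z → z :- Solver.con 1ℤ :+ (x :- Solver.con 1ℤ) :* z := x :* z :- Solver.con 1ℤ) 𝕊.refl (X 1) (X 1 ^ n) ⟩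
  X 1 ⊛ X 1 ^ n ⊕ ⊖ const 1ℤ
    ≈⟨ U-^ (suc n) ⟩
  U (suc n) ∎
  where open ≋-Reasoning

Bounded-^ : ∀ {n N} → n < N → Bounded N (X 1 ^ n)
Bounded-^ {n} n<N k N≤k = trans (X-^ n .at k) (X-Bounded n k (ℕ.≤-trans n<N N≤k))

Monic-⊕^ : ∀ {n f} → Bounded n f → Monic n (f ⊕ X 1 ^ n)
Monic-⊕^ {n} {f} b = Monic-cong (𝕊.+-congˡ {f} (≋-sym (X-^ n))) (Monic-⊕X b)

Monic-ψ : ∀ n → Monic n (ψ n)
Monic-ψ n = Monic-⊕^ (Bounded-Σ n _ λ i i<n → Bounded-^ i<n)

Monic-Φ₂ : ∀ p′ k → Monic (p′ * (k * suc p′)) (Φ₂ p′ k (X 1))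
Monic-Φ₂ p′ k = Monic-⊕^ (Bounded-Σ p′ _ λ a a<p′ → Bounded-Σ k _ λ b b<k →
  Bounded-⊕ (Bounded-^ (ℕ.≤-<-trans (ℕ.m≤m+n _ (suc a)) (bound a<p′ b<k))) (Bounded-⊖ (Bounded-^ (bound a<p′ b<k))))
  where
  bound : ∀ {a b} → a < p′ → b < k → index p′ k a b + suc a < p′ * (k * suc p′)
  bound {a} {b} a<p′ b<k = begin-strict
    a * m + b * p + suc a      ≡⟨ ℕ.+-assoc (a * m) (b * p) (suc a) ⟩
    a * m + (b * p + suc a)    <⟨ ℕ.+-monoʳ-< (a * m) (ℕ.+-monoʳ-< (b * p) (s≤s a<p′)) ⟩
    a * m + (b * p + p)        ≡⟨ cong (a * m +_) (ℕ.+-comm (b * p) p) ⟩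
    a * m + suc b * p          ≤⟨ ℕ.+-monoʳ-≤ (a * m) (ℕ.*-monoˡ-≤ p b<k) ⟩
    a * m + m                  ≡⟨ ℕ.+-comm (a * m) m ⟩
    suc a * m                  ≤⟨ ℕ.*-monoˡ-≤ m a<p′ ⟩
    p′ * m ∎
    where
    open ℕ.≤-Reasoning
    p = suc p′
    m = k * p

Φ₂-U : ∀ {p′ k q} → q ≡ suc (k * suc p′) →
  Φ₂ p′ k (X 1) ⊛ (U (suc p′) ⊛ U q) ≋ U (suc p′ * q) ⊛ U 1
Φ₂-U {p′} {k} {q} refl = begin
  Φ₂ p′ k (X 1) ⊛ (U p ⊛ U q)
    ≈⟨ 𝕊.*-congˡ {Φ₂ p′ k (X 1)} (⊛-cong (U-^ p) (U-^ q)) ⟨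
  Φ₂ p′ k (X 1) ⊛ ((X 1 ^ p ⊕ ⊖ const 1ℤ) ⊛ (X 1 ^ q ⊕ ⊖ const 1ℤ))
    ≈⟨ Φ₂-spec p′ k (X 1) ⟩
  (X 1 ^ (p * q) ⊕ ⊖ const 1ℤ) ⊛ U 1
    ≈⟨ 𝕊.*-congʳ {U 1} (U-^ (p * q)) ⟩
  U (p * q) ⊛ U 1 ∎
  where
  open ≋-Reasoning
  p = suc p′

cycloF-1 : ∀ f → coeff (cycloF (suc f) 1) ≋ U 1
cycloF-1 f = cycloF-suc {ds = []} {fs = []} f 1 ↭.refl [] [] (Monic-U 0)
  (≋-sym (𝕊.*-identityʳ (U 1)))

cycloF-p : ∀ {p′} f → Prime (suc p′) → coeff (cycloF (suc (suc f)) (suc p′)) ≋ ψ p′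
cycloF-p {p′} f pp = cycloF-suc (suc f) (suc p′) (properDivisors-p pp) (cycloF-1 f ∷ []) ((1 , Monic-U 0) ∷ []) (Monic-ψ p′)
  (≋-trans (≋-sym (ψ-spec p′)) (solve 2 (λ u s → u :* s := s :* (u :* Solver.con 1ℤ)) 𝕊.refl (U 1) (ψ p′)))

cycloF-pq : ∀ {p′ q′} k f → Prime (suc p′) → Prime (suc q′) → p′ < q′ → q′ ≡ k * suc p′ →
  coeff (cycloF (suc (suc (suc f))) (suc p′ * suc q′)) ≋ Φ₂ p′ k (X 1)
cycloF-pq {p′} {q′} k f pp pq p<q q≡ = cycloF-suc (suc (suc f)) (p * q) (properDivisors-pq pp pq (s≤s p<q))
  (cycloF-1 (suc f) ∷ cycloF-p f pp ∷ cycloF-p f pq ∷ [])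
  ((1 , Monic-U 0) ∷ (_ , Monic-ψ p′) ∷ (_ , Monic-ψ q′) ∷ [])
  (Monic-Φ₂ p′ k)
  -- One factor `U 1` appears on both sides of `Φ₂-U` once both `ψ` are expressed through `ψ-spec`;
  -- the second brings the constant term from -1 to 1.
  (unit-cancel (U 1 ⊛ U 1) refl (begin
    U 1 ⊛ U 1 ⊛ U (p * q)
      ≈⟨ solve 2 (λ u n → u :* u :* n := u :* (n :* u)) 𝕊.refl (U 1) (U (p * q)) ⟩
    U 1 ⊛ (U (p * q) ⊛ U 1)
      ≈⟨ 𝕊.*-congˡ {U 1} (Φ₂-U {p′} {k} {q} (cong suc q≡)) ⟨
    U 1 ⊛ (C ⊛ (U p ⊛ U q))
      ≈⟨ 𝕊.*-congˡ {U 1} (𝕊.*-congˡ {C} (⊛-cong (ψ-spec p′) (ψ-spec q′))) ⟨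
    U 1 ⊛ (C ⊛ ((U 1 ⊛ ψ p′) ⊛ (U 1 ⊛ ψ q′)))
      ≈⟨ solve 4 (λ u C s t → u :* (C :* ((u :* s) :* (u :* t))) := u :* u :* (C :* (u :* (s :* (t :* Solver.con 1ℤ)))))
           𝕊.refl (U 1) C (ψ p′) (ψ q′) ⟩
    U 1 ⊛ U 1 ⊛ (C ⊛ prodS (U 1 ∷ ψ p′ ∷ ψ q′ ∷ [])) ∎))
  where
  open ≋-Reasoning
  p = suc p′
  q = suc q′
  C = Φ₂ p′ k (X 1)

-- The congruences give `r = (l * q) * p + 1 = (l * p) * q + 1`, so the explicit form `Φ₂` covers
-- all three pairs of primes.
cycloF-pqr : ∀ {p′ q′ r′ k l N T} f → Prime (suc p′) → Prime (suc q′) → Prime (suc r′) → p′ < q′ →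
  q′ ≡ k * suc p′ → r′ ≡ l * (suc p′ * suc q′) → suc p′ * suc q′ ≤ r′ → Monic N T →
  U 1 ⊛ U (suc p′ * suc q′) ⊛ T ≋ U (suc p′) ⊛ U (suc q′) ⊛ Φ₂ p′ k (X (suc r′)) →
  coeff (cycloF (suc (suc (suc (suc f)))) (suc p′ * suc q′ * suc r′)) ≋ T
cycloF-pqr {p′} {q′} {r′} {k} {l} {N} {T} f pp pq pr p<q q≡ r≡ pq≤r′ MT hT =
  cycloF-suc (suc (suc (suc f))) (p * q * r) (properDivisors-pqr pp pq pr (s≤s p<q) (s≤s pq≤r′))
    (cycloF-1 (suc (suc f)) ∷ cycloF-p (suc f) pp ∷ cycloF-p (suc f) pq ∷ cycloF-pq k f pp pq p<q q≡
      ∷ cycloF-p (suc f) pr ∷ cycloF-pq (l * q) f pp pr (ℕ.<-trans p<q q<r) r≡p ∷ cycloF-pq (l * p) f pq pr q<r r≡q ∷ [])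
    ((1 , Monic-U 0) ∷ (_ , Monic-ψ p′) ∷ (_ , Monic-ψ q′) ∷ (_ , Monic-Φ₂ p′ k)
      ∷ (_ , Monic-ψ r′) ∷ (_ , Monic-Φ₂ p′ (l * q)) ∷ (_ , Monic-Φ₂ q′ (l * p)) ∷ [])
    MT
    -- The three `Φ₂` are known through their products with `a ⊛ b`, `a ⊛ c` and `b ⊛ c`. The three
    -- `ψ` each need a factor `u`, one of which is already the divisor 1. These are eight factors
    -- with constant term -1, hence a product with constant term 1.
    (unit-cancel (u ⊛ u ⊛ (a ⊛ b ⊛ (a ⊛ c) ⊛ (b ⊛ c))) refl (begin
      u ⊛ u ⊛ (a ⊛ b ⊛ (a ⊛ c) ⊛ (b ⊛ c)) ⊛ n
        ≈⟨ solve 5 (λ u a b c n → u :* u :* (a :* b :* (a :* c) :* (b :* c)) :* n := u :* u :* (a :* b :* c :* (a :* b)) :* (n :* c)) 𝕊.refl u a b c n ⟩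
      u ⊛ u ⊛ (a ⊛ b ⊛ c ⊛ (a ⊛ b)) ⊛ (n ⊛ c)
        ≈⟨ 𝕊.*-congˡ {u ⊛ u ⊛ (a ⊛ b ⊛ c ⊛ (a ⊛ b))} Φ₂-r ⟨
      u ⊛ u ⊛ (a ⊛ b ⊛ c ⊛ (a ⊛ b)) ⊛ (F ⊛ (e ⊛ g))
        ≈⟨ solve 7 (λ u a b c F e g → u :* u :* (a :* b :* c :* (a :* b)) :* (F :* (e :* g))
             := u :* u :* (a :* b :* c) :* (e :* g) :* (a :* b :* F)) 𝕊.refl u a b c F e g ⟩
      u ⊛ u ⊛ (a ⊛ b ⊛ c) ⊛ (e ⊛ g) ⊛ (a ⊛ b ⊛ F)
        ≈⟨ 𝕊.*-congˡ {u ⊛ u ⊛ (a ⊛ b ⊛ c) ⊛ (e ⊛ g)} hT ⟨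
      u ⊛ u ⊛ (a ⊛ b ⊛ c) ⊛ (e ⊛ g) ⊛ (u ⊛ d ⊛ T)
        ≈⟨ solve 8 (λ u a b c d e g T → u :* u :* (a :* b :* c) :* (e :* g) :* (u :* d :* T)
             := a :* b :* c :* (d :* u) :* ((e :* u) :* (g :* u)) :* T) 𝕊.refl u a b c d e g T ⟩
      a ⊛ b ⊛ c ⊛ (d ⊛ u) ⊛ ((e ⊛ u) ⊛ (g ⊛ u)) ⊛ T
        ≈⟨ 𝕊.*-congʳ {T} (⊛-cong
             (⊛-cong (⊛-cong (⊛-cong (ψ-spec p′) (ψ-spec q′)) (ψ-spec r′)) (Φ₂-U {p′} {k} {q} (cong suc q≡)))
             (⊛-cong (Φ₂-U {p′} {l * q} {r} (cong suc r≡p)) (Φ₂-U {q′} {l * p} {r} (cong suc r≡q)))) ⟨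
      u ⊛ A ⊛ (u ⊛ B) ⊛ (u ⊛ C) ⊛ (D ⊛ (a ⊛ b)) ⊛ ((E ⊛ (a ⊛ c)) ⊛ (G ⊛ (b ⊛ c))) ⊛ T
        ≈⟨ collect u (a ⊛ b) (a ⊛ c) (b ⊛ c) A B C D E G T ⟩
      u ⊛ u ⊛ (a ⊛ b ⊛ (a ⊛ c) ⊛ (b ⊛ c)) ⊛ (T ⊛ prodS (u ∷ A ∷ B ∷ D ∷ C ∷ E ∷ G ∷ [])) ∎))
  where
  open ≋-Reasoning
  p = suc p′
  q = suc q′
  r = suc r′
  u = U 1
  a = U p
  b = U q
  c = U r
  d = U (p * q)
  e = U (p * r)
  g = U (q * r)
  n = U (p * q * r)
  A = ψ p′
  B = ψ q′
  C = ψ r′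
  D = Φ₂ p′ k (X 1)
  E = Φ₂ p′ (l * q) (X 1)
  G = Φ₂ q′ (l * p) (X 1)
  F = Φ₂ p′ k (X r)

  q<r : q′ < r′
  q<r = ℕ.≤-trans (ℕ.m≤m+n q (p′ * q)) pq≤r′
  r≡p : r′ ≡ l * q * p
  r≡p = trans r≡ (trans (cong (l *_) (ℕ.*-comm p q)) (sym (ℕ.*-assoc l q p)))
  r≡q : r′ ≡ l * p * q
  r≡q = trans r≡ (sym (ℕ.*-assoc l p q))

  U-r : ∀ m → X r ^ m ⊕ ⊖ const 1ℤ ≋ U (m * r)
  U-r m = 𝕊.+-congʳ {⊖ const 1ℤ} (≋-trans (^-congˡ m (≋-sym (X-^ r)))
    (≋-trans (^-assocʳ (X 1) r m) (≋-trans (X-^ (r * m)) (𝕊.reflexive (cong X (ℕ.*-comm r m))))))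

  Φ₂-r : F ⊛ (e ⊛ g) ≋ n ⊛ c
  Φ₂-r = ≋-trans (𝕊.*-congˡ {F} (⊛-cong (≋-sym (U-r p)) (≋-sym (≋-trans (𝕊.reflexive (cong (λ m → X r ^ suc m ⊕ ⊖ const 1ℤ) (sym q≡))) (U-r q)))))
    (≋-trans (Φ₂-spec p′ k (X r)) (𝕊.*-congʳ {c}
      (≋-trans (𝕊.reflexive (cong (λ m → X r ^ (p * suc m) ⊕ ⊖ const 1ℤ) (sym q≡))) (U-r (p * q)))))

  collect : ∀ u ab ac bc A B C D E G T →
    u ⊛ A ⊛ (u ⊛ B) ⊛ (u ⊛ C) ⊛ (D ⊛ ab) ⊛ ((E ⊛ ac) ⊛ (G ⊛ bc)) ⊛ T
    ≋ u ⊛ u ⊛ (ab ⊛ ac ⊛ bc) ⊛ (T ⊛ prodS (u ∷ A ∷ B ∷ D ∷ C ∷ E ∷ G ∷ []))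
  collect = solve 11 (λ u ab ac bc A B C D E G T →
    u :* A :* (u :* B) :* (u :* C) :* (D :* ab) :* ((E :* ac) :* (G :* bc)) :* T
    := u :* u :* (ab :* ac :* bc) :* (T :* (u :* (A :* (B :* (D :* (C :* (E :* (G :* Solver.con 1ℤ))))))))) 𝕊.refl

-- Formal sums with ascending exponents

monomial : Term → Series
monomial (c , e) = const c ⊛ X e

X-off-diag : ∀ e k → e ≢ k → X e k ≡ 0ℤ
X-off-diag zero    zero    e≢k = ⊥-elim (e≢k refl)
X-off-diag zero    (suc k) e≢k = refl
X-off-diag (suc e) zero    e≢k = refl
X-off-diag (suc e) (suc k) e≢k = X-off-diag e k (e≢k ∘ cong suc)

coeffT-∷ : ∀ t ts → coeffT (t ∷ ts) ≋ monomial t ⊕ coeffT ts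
coeffT-∷ (c , e) ts .at k with e ℕ.≟ k
... | yes refl = cong (λ z → z ℤ.+ coeffT ts k) (sym
  (trans (const-⊛ c (X e) k) (trans (cong (c ℤ.*_) (X-diag e)) (ℤ.*-identityʳ c))))
... | no e≢k = trans (sym (ℤ.+-identityˡ _)) (cong (λ z → z ℤ.+ coeffT ts k) (sym
  (trans (const-⊛ c (X e) k) (trans (cong (c ℤ.*_) (X-off-diag e k e≢k)) (ℤ.*-zeroʳ c)))))

coeffT-++ : ∀ ts us → coeffT (ts ++ us) ≋ coeffT ts ⊕ coeffT us
coeffT-++ []       us = ≋-sym (𝕊.+-identityˡ (coeffT us))
coeffT-++ (t ∷ ts) us = begin
  coeffT (t ∷ ts ++ us)                  ≈⟨ coeffT-∷ t (ts ++ us) ⟩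
  monomial t ⊕ coeffT (ts ++ us)         ≈⟨ 𝕊.+-congˡ {monomial t} (coeffT-++ ts us) ⟩
  monomial t ⊕ (coeffT ts ⊕ coeffT us)   ≈⟨ 𝕊.+-assoc (monomial t) (coeffT ts) (coeffT us) ⟨
  monomial t ⊕ coeffT ts ⊕ coeffT us     ≈⟨ 𝕊.+-congʳ {coeffT us} (coeffT-∷ t ts) ⟨
  coeffT (t ∷ ts) ⊕ coeffT us ∎
  where open ≋-Reasoning

coeffT-map : ∀ h s → (∀ t → monomial (h t) ≋ s ⊛ monomial t) → ∀ ts → coeffT (map h ts) ≋ s ⊛ coeffT ts
coeffT-map h s e []       = ≋-sym (𝕊.zeroʳ s)
coeffT-map h s e (t ∷ ts) = begin
  coeffT (h t ∷ map h ts)                 ≈⟨ coeffT-∷ (h t) (map h ts) ⟩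
  monomial (h t) ⊕ coeffT (map h ts)      ≈⟨ 𝕊.+-cong (e t) (coeffT-map h s e ts) ⟩
  s ⊛ monomial t ⊕ s ⊛ coeffT ts          ≈⟨ 𝕊.distribˡ s (monomial t) (coeffT ts) ⟨
  s ⊛ (monomial t ⊕ coeffT ts)            ≈⟨ 𝕊.*-congˡ {s} (coeffT-∷ t ts) ⟨
  s ⊛ coeffT (t ∷ ts) ∎
  where open ≋-Reasoning

coeffT-shift : ∀ d ts → coeffT (map (λ t → proj₁ t , proj₂ t + d) ts) ≋ X d ⊛ coeffT ts
coeffT-shift d = coeffT-map _ (X d) λ (c , e) → ≋-trans (𝕊.*-congˡ {const c} (X-+ e d))
  (solve 3 (λ c e d → c :* (e :* d) := d :* (c :* e)) 𝕊.refl (const c) (X e) (X d))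

coeffT-neg-shift : ∀ d ts → coeffT (map (λ t → ℤ.- proj₁ t , d + proj₂ t) ts) ≋ (⊖ X d) ⊛ coeffT ts
coeffT-neg-shift d = coeffT-map _ (⊖ X d) λ (c , e) →
  ≋-trans (⊛-cong {const (ℤ.- c)} {⊖ const c} (pointwise λ { zero → refl ; (suc n) → refl }) (X-+ d e))
  (solve 3 (λ c e d → (:- c) :* (d :* e) := (:- d) :* (c :* e)) 𝕊.refl (const c) (X e) (X d))

coeffT-concatMap : ∀ (f : ℕ → List Term) n → coeffT (concatMap f (upTo n)) ≋ Σ n (coeffT ∘ f)
coeffT-concatMap f n rewrite List.map-upTo f n = go f n
  where
  go : ∀ (f : ℕ → List Term) n → coeffT (concat (applyUpTo f n)) ≋ Σ n (coeffT ∘ f)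
  go f zero    = ≋-refl
  go f (suc n) = ≋-trans (coeffT-++ (f 0) _) (𝕊.+-congˡ {coeffT (f 0)} (go (f ∘ suc) n))

coeffT-run : ∀ c e n → coeffT (map (λ j → c , e + j) (upTo n)) ≋ const c ⊛ X e ⊛ Σ n (X 1 ^_)
coeffT-run c e n rewrite List.map-upTo (λ j → c , e + j) n =
  ≋-trans (go (λ j → c , e + j) n) (≋-trans (Σ-cong n λ i _ →
      ≋-trans (𝕊.*-congˡ {const c} (≋-trans (X-+ e i) (𝕊.*-congˡ {X e} (≋-sym (X-^ i)))))
        (≋-sym (𝕊.*-assoc (const c) (X e) (X 1 ^ i))))
    (≋-sym (Σ-scaleˡ n (const c ⊛ X e) (X 1 ^_))))
  where
  go : ∀ (f : ℕ → Term) n → coeffT (applyUpTo f n) ≋ Σ n (monomial ∘ f)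
  go f zero    = ≋-refl
  go f (suc n) = ≋-trans (coeffT-∷ (f 0) _) (𝕊.+-congˡ {monomial (f 0)} (go (f ∘ suc) n))

-- Strictly ascending exponents inside the half-open interval `[lo, hi)`. Keeping both ends lets
-- adjacent intervals be concatenated, and the upper end serves as a degree bound.
data Ascending : ℕ → List Term → ℕ → Set where
  []  : ∀ {lo hi} → lo ≤ hi → Ascending lo [] hi
  _∷_ : ∀ {lo c e ts hi} → lo ≤ e → Ascending (suc e) ts hi → Ascending lo ((c , e) ∷ ts) hi

weaken : ∀ {lo lo′ ts hi} → lo′ ≤ lo → Ascending lo ts hi → Ascending lo′ ts hi
weaken lo′≤lo ([] lo≤hi)   = [] (ℕ.≤-trans lo′≤lo lo≤hi)
weaken lo′≤lo (lo≤e ∷ ts↑) = ℕ.≤-trans lo′≤lo lo≤e ∷ ts↑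

Ascending-++ : ∀ {a ts b us c} → Ascending a ts b → Ascending b us c → Ascending a (ts ++ us) c
Ascending-++ ([] a≤b)    us↑ = weaken a≤b us↑
Ascending-++ (a≤e ∷ ts↑) us↑ = a≤e ∷ Ascending-++ ts↑ us↑

Ascending-raise : ∀ {a ts b b′} → b ≤ b′ → Ascending a ts b → Ascending a ts b′
Ascending-raise b≤b′ ([] a≤b)    = [] (ℕ.≤-trans a≤b b≤b′)
Ascending-raise b≤b′ (a≤e ∷ ts↑) = a≤e ∷ Ascending-raise b≤b′ ts↑

Ascending-shift : ∀ {h : Term → Term} d → (∀ t → proj₂ (h t) ≡ d + proj₂ t) →
  ∀ {a ts b} → Ascending a ts b → Ascending (d + a) (map h ts) (d + b)
Ascending-shift d e ([] a≤b) = [] (ℕ.+-monoʳ-≤ d a≤b)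
Ascending-shift d e (_∷_ {e = i} a≤i ts↑) =
  subst (_ ≤_) (sym (e _)) (ℕ.+-monoʳ-≤ d a≤i)
  ∷ weaken (ℕ.≤-reflexive (trans (cong suc (e _)) (sym (ℕ.+-suc d i)))) (Ascending-shift d e ts↑)

Ascending-run : ∀ c e n → Ascending e (map (λ j → c , e + j) (upTo n)) (e + n)
Ascending-run c e n rewrite List.map-upTo (λ j → c , e + j) n =
  subst (λ lo → Ascending lo (applyUpTo (λ j → c , e + j) n) (e + n)) (ℕ.+-identityʳ e) (go (λ j → e + j) n (λ i → ℕ.+-suc e i))
  where
  go : ∀ (f : ℕ → ℕ) n → (∀ i → f (suc i) ≡ suc (f i)) → Ascending (f 0) (applyUpTo (λ j → c , f j) n) (f n)
  go f zero    e = [] ℕ.≤-refl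
  go f (suc n) e = ℕ.≤-refl ∷ weaken (ℕ.≤-reflexive (sym (e 0))) (go (f ∘ suc) n (e ∘ suc))

Ascending-blocks : ∀ o s n f → (∀ i → i < n → Ascending (o + i * s) (f i) (o + suc i * s)) →
  Ascending o (concatMap f (upTo n)) (o + n * s)
Ascending-blocks o s n f blocks rewrite List.map-upTo f n =
  subst (λ lo → Ascending lo (concat (applyUpTo f n)) (o + n * s)) (ℕ.+-identityʳ o) (go (λ i → o + i * s) f n blocks)
  where
  go : ∀ (g : ℕ → ℕ) (f : ℕ → List Term) n → (∀ i → i < n → Ascending (g i) (f i) (g (suc i))) →
    Ascending (g 0) (concat (applyUpTo f n)) (g n)
  go g f zero    b = [] ℕ.≤-refl
  go g f (suc n) b = Ascending-++ (b 0 (s≤s z≤n)) (go (g ∘ suc) (f ∘ suc) n λ i i<n → b (suc i) (s≤s i<n))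

Ascending⇒Linked : ∀ {lo ts hi} → Ascending lo ts hi → Linked _<_ (exponents ts)
Ascending⇒Linked ([] _)                    = []
Ascending⇒Linked (_ ∷ [] _)                = [-]
Ascending⇒Linked (_ ∷ ts↑@(e<e′ ∷ _))      = e<e′ ∷ Ascending⇒Linked ts↑

Ascending-≤ : ∀ {lo ts hi} → Ascending lo ts hi → lo ≤ hi
Ascending-≤ ([] lo≤hi)     = lo≤hi
Ascending-≤ (lo≤e ∷ ts↑) = ℕ.≤-trans lo≤e (ℕ.<⇒≤ (Ascending-≤ ts↑))

Ascending⇒Bounded : ∀ {lo ts hi} → Ascending lo ts hi → Bounded hi (coeffT ts)
Ascending⇒Bounded ([] _) k hi≤k = refl
Ascending⇒Bounded {ts = (c , e) ∷ ts} (_ ∷ ts↑) k hi≤k with e ℕ.≟ k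
... | yes refl = ⊥-elim (ℕ.<⇒≱ (Ascending-≤ ts↑) hi≤k)
... | no  _    = Ascending⇒Bounded ts↑ k hi≤k

-- The expansion

fdiv-suc : ∀ k d → 1 < d → fdiv (suc (k * d)) d ≡ k
fdiv-suc k (suc d) 1<d = begin
  suc (k * suc d) / suc d         ≡⟨ +-distrib-/-∣ʳ 1 {k * suc d} (n∣m*n k) ⟩
  1 / suc d + k * suc d / suc d   ≡⟨ cong₂ _+_ (m<n⇒m/n≡0 1<d) (m*n/n≡m k (suc d)) ⟩
  k ∎
  where open ≡-Reasoning

X-* : ∀ i j → X (i * j) ≋ X i ^ j
X-* i j = ≋-trans (≋-sym (X-^ (i * j))) (≋-trans (≋-sym (^-assocʳ (X 1) i j)) (^-congˡ j (X-^ i)))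

module _ (p′ k l : ℕ) where

  private
    p = suc p′
    m = k * p
    q = suc m
    r′ = l * (p * q)
    r = suc r′
    ℓ = index p′ k

  open Construction p q r

  -- The ranges of the second and fourth index are parameters, so that the floor divisions `q₂` and
  -- `q₃` can be exchanged for `k` and `l` by congruence.
  terms : ℕ → ℕ → List Term
  terms n₂ n₄ =
    concatMap (λ a → concatMap (λ b → concatMap (λ c → concatMap (λ d → shiftedTerms a b c d)
      (upTo n₄)) (upTo p)) (upTo n₂)) (upTo p′)

  g : ℕ → ℕ → ℕ → Series
  g a b c = coeffT (gTerms a b c)

  run-series : ∀ e n → U 1 ⊛ (X e ⊛ Σ n (X 1 ^_)) ≋ X e ⊛ (X 1 ^ n ⊕ ⊖ const 1ℤ)
  run-series e n = ≋-trans
    (solve 3 (λ u e s → u :* (e :* s) := e :* (u :* s)) 𝕊.refl (U 1) (X e) (Σ n (X 1 ^_)))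
    (𝕊.*-congˡ {X e} (geometric n (X 1)))

  X-ℓ : ∀ {e} a b i → e ≡ ℓ a b + i → X e ≋ X 1 ^ ℓ a b ⊛ X 1 ^ i
  X-ℓ a b i refl = ≋-trans (X-+ (ℓ a b) i) (⊛-cong (≋-sym (X-^ (ℓ a b))) (≋-sym (X-^ i)))

  -- As `a * q = a * m + a`, the run of monomials starts at `ℓ a b + suc a`; having `p′ ∸ a` terms,
  -- it stops just before `ℓ a b + p`. In the other case the run starts at `ℓ a b + p` and has
  -- `suc a` terms, with negative sign.
  g-below : ∀ {a b c} → a < p′ → c ≤ a → U 1 ⊛ g a b c ≋ X 1 ^ ℓ a b ⊛ (X 1 ^ p ⊕ ⊖ X 1 ^ suc a)
  g-below {a} {b} {c} a<p′ c≤a with c ≤? a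
  ... | no c≰a = ⊥-elim (c≰a c≤a)
  ... | yes _ = begin
    U 1 ⊛ coeffT (map (λ j → 1ℤ , e + j) (upTo n))
      ≈⟨ 𝕊.*-congˡ {U 1} (≋-trans (coeffT-run 1ℤ e n) (𝕊.*-congʳ {Σ n (X 1 ^_)} (⊛-identityˡ (X e)))) ⟩
    U 1 ⊛ (X e ⊛ Σ n (X 1 ^_))
      ≈⟨ run-series e n ⟩
    X e ⊛ (X 1 ^ n ⊕ ⊖ const 1ℤ)
      ≈⟨ 𝕊.*-congʳ {X 1 ^ n ⊕ ⊖ const 1ℤ} (X-ℓ a b (suc a) (start-below a b m p)) ⟩
    X 1 ^ ℓ a b ⊛ X 1 ^ suc a ⊛ (X 1 ^ n ⊕ ⊖ const 1ℤ)
      ≈⟨ solve 3 (λ x s n → x :* s :* (n :- Solver.con 1ℤ) := x :* (s :* n :- s)) 𝕊.refl (X 1 ^ ℓ a b) (X 1 ^ suc a) (X 1 ^ n) ⟩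
    X 1 ^ ℓ a b ⊛ (X 1 ^ suc a ⊛ X 1 ^ n ⊕ ⊖ X 1 ^ suc a)
      ≈⟨ 𝕊.*-congˡ {X 1 ^ ℓ a b} (𝕊.+-congʳ {⊖ X 1 ^ suc a} (≋-trans (≋-sym (^-homo-* (X 1) (suc a) n))
           (^-congʳ (X 1) (cong suc (ℕ.m+[n∸m]≡n (ℕ.<⇒≤ a<p′)))))) ⟩
    X 1 ^ ℓ a b ⊛ (X 1 ^ p ⊕ ⊖ X 1 ^ suc a) ∎
    where
    open ≋-Reasoning
    e = a * q + b * p + 1
    n = p′ ∸ a

  g-above : ∀ {a b c} → a < p′ → a < c → U 1 ⊛ g a b c ≋ X 1 ^ ℓ a b ⊛ X 1 ^ p ⊛ (const 1ℤ ⊕ ⊖ X 1 ^ suc a)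
  g-above {a} {b} {c} a<p′ a<c with c ≤? a
  ... | yes c≤a = ⊥-elim (ℕ.<⇒≱ a<c c≤a)
  ... | no _ = begin
    U 1 ⊛ coeffT (map (λ j → -1ℤ , e + j) (upTo (a + 1)))
      ≈⟨ 𝕊.*-congˡ {U 1} (coeffT-run -1ℤ e (a + 1)) ⟩
    U 1 ⊛ (const -1ℤ ⊛ X e ⊛ Σ (a + 1) (X 1 ^_))
      ≈⟨ solve 3 (λ u e s → u :* (Solver.con -1ℤ :* e :* s) := :- (u :* (e :* s))) 𝕊.refl (U 1) (X e) (Σ (a + 1) (X 1 ^_)) ⟩
    ⊖ (U 1 ⊛ (X e ⊛ Σ (a + 1) (X 1 ^_)))
      ≈⟨ 𝕊.-‿cong (≋-trans (run-series e (a + 1)) (⊛-cong (X-ℓ a b p (start-above a b m p))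
           (𝕊.+-congʳ {⊖ const 1ℤ} (^-congʳ (X 1) (ℕ.+-comm a 1))))) ⟩
    ⊖ (X 1 ^ ℓ a b ⊛ X 1 ^ p ⊛ (X 1 ^ suc a ⊕ ⊖ const 1ℤ))
      ≈⟨ solve 2 (λ e s → :- (e :* (s :- Solver.con 1ℤ)) := e :* (Solver.con 1ℤ :- s)) 𝕊.refl (X 1 ^ ℓ a b ⊛ X 1 ^ p) (X 1 ^ suc a) ⟩
    X 1 ^ ℓ a b ⊛ X 1 ^ p ⊛ (const 1ℤ ⊕ ⊖ X 1 ^ suc a) ∎
    where
    open ≋-Reasoning
    e = a * m + (b + 1) * p

  f : ℕ → ℕ → ℕ → Series
  f a b c = const 1ℤ ⊕ g a b c ⊕ ⊖ X 1 ^ (suc a * q) ⊕ ⊖ (X 1 ^ q ⊛ g a b c)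

  coeffT-fTerms : ∀ a b c → coeffT (fTerms a b c) ≋ f a b c
  coeffT-fTerms a b c = begin
    coeffT (fTerms a b c)
      ≈⟨ ≋-trans (coeffT-∷ (1ℤ , 0) _) (𝕊.+-congˡ {monomial (1ℤ , 0)} (≋-trans (coeffT-++ (gTerms a b c) _)
           (𝕊.+-congˡ {g a b c} (≋-trans (coeffT-∷ (-1ℤ , (a + 1) * q) _)
             (𝕊.+-congˡ {monomial (-1ℤ , (a + 1) * q)} (coeffT-neg-shift q (gTerms a b c))))))) ⟩
    const 1ℤ ⊛ X 0 ⊕ (g a b c ⊕ (const -1ℤ ⊛ X ((a + 1) * q) ⊕ (⊖ X q) ⊛ g a b c))
      ≈⟨ solve 3 (λ g s y → Solver.con 1ℤ :* Solver.con 1ℤ :+ (g :+ (Solver.con -1ℤ :* s :+ (:- y) :* g))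
           := Solver.con 1ℤ :+ g :- s :- y :* g) 𝕊.refl (g a b c) (X ((a + 1) * q)) (X q) ⟩
    const 1ℤ ⊕ g a b c ⊕ ⊖ X ((a + 1) * q) ⊕ ⊖ (X q ⊛ g a b c)
      ≈⟨ 𝕊.+-cong (𝕊.+-congˡ {const 1ℤ ⊕ g a b c} (𝕊.-‿cong (≋-trans (𝕊.reflexive (cong (λ n → X (n * q)) (ℕ.+-comm a 1))) (≋-sym (X-^ (suc a * q))))))
           (𝕊.-‿cong (𝕊.*-congʳ {g a b c} (≋-sym (X-^ q)))) ⟩
    f a b c ∎
    where open ≋-Reasoning

  Y D W : Series
  Y = X r′
  D = Σ l (X (p * q) ^_)
  W = Σ p′ λ a → Σ k λ b → Σ p λ c → Y ^ (ℓ a b + c) ⊛ f a b c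

  coeffT-shiftedTerms : ∀ a b c → Σ l (λ d → coeffT (shiftedTerms a b c d)) ≋ D ⊛ (Y ^ (ℓ a b + c) ⊛ f a b c)
  coeffT-shiftedTerms a b c = begin
    Σ l (λ d → coeffT (shiftedTerms a b c d))
      ≈⟨ Σ-cong l (λ d _ → ≋-trans (coeffT-shift (dotρ a b c d) (fTerms a b c)) (⊛-cong (X-dotρ d) (coeffT-fTerms a b c))) ⟩
    Σ l (λ d → Y ^ (ℓ a b + c) ⊛ X (p * q) ^ d ⊛ f a b c)
      ≈⟨ Σ-cong l (λ d _ → solve 3 (λ y z f → y :* z :* f := y :* f :* z) 𝕊.refl (Y ^ (ℓ a b + c)) (X (p * q) ^ d) (f a b c)) ⟩
    Σ l (λ d → Y ^ (ℓ a b + c) ⊛ f a b c ⊛ X (p * q) ^ d)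
      ≈⟨ Σ-scaleˡ l (Y ^ (ℓ a b + c) ⊛ f a b c) (X (p * q) ^_) ⟨
    Y ^ (ℓ a b + c) ⊛ f a b c ⊛ D
      ≈⟨ 𝕊.*-comm (Y ^ (ℓ a b + c) ⊛ f a b c) D ⟩
    D ⊛ (Y ^ (ℓ a b + c) ⊛ f a b c) ∎
    where
    open ≋-Reasoning
    X-dotρ : ∀ d → X (dotρ a b c d) ≋ Y ^ (ℓ a b + c) ⊛ X (p * q) ^ d
    X-dotρ d = ≋-trans (𝕊.reflexive (cong X (dotρ-collect a b c d m p r′ (p * q))))
      (≋-trans (X-+ (r′ * (ℓ a b + c)) (p * q * d)) (⊛-cong (X-* r′ (ℓ a b + c)) (X-* (p * q) d)))

  coeffT-terms : coeffT (terms k l) ≋ W ⊛ D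
  coeffT-terms = begin
    coeffT (terms k l)
      ≈⟨ ≋-trans (coeffT-concatMap _ p′) (Σ-cong p′ λ a _ → ≋-trans (coeffT-concatMap _ k)
           (Σ-cong k λ b _ → ≋-trans
             (coeffT-concatMap (λ c → concatMap (shiftedTerms a b c) (upTo l)) p) (Σ-cong p λ c _ →
             ≋-trans (coeffT-concatMap (shiftedTerms a b c) l) (coeffT-shiftedTerms a b c)))) ⟩
    Σ p′ (λ a → Σ k λ b → Σ p λ c → D ⊛ (Y ^ (ℓ a b + c) ⊛ f a b c))
      ≈⟨ ≋-trans (Σ-scaleˡ p′ D _) (Σ-cong p′ λ a _ → ≋-trans (Σ-scaleˡ k D _)
           (Σ-cong k λ b _ → Σ-scaleˡ p D (λ c → Y ^ (ℓ a b + c) ⊛ f a b c))) ⟨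
    D ⊛ W
      ≈⟨ 𝕊.*-comm D W ⟩
    W ⊛ D ∎
    where open ≋-Reasoning

  -- The totient of `p * q * r`, bracketed as the end of `p′` consecutive blocks of length `m * r′`.
  degree : ℕ
  degree = p′ * (m * r′)

  series : Series
  series = coeffT (terms k l ++ [ (1ℤ , degree) ])

  series-split : series ≋ coeffT (terms k l) ⊕ X degree
  series-split = ≋-trans (coeffT-++ (terms k l) _) (𝕊.+-congˡ {coeffT (terms k l)}
    (≋-trans (coeffT-∷ (1ℤ , degree) []) (≋-trans (𝕊.+-identityʳ (monomial (1ℤ , degree))) (⊛-identityˡ (X degree)))))

  series-factorization : U 1 ⊛ U (p * q) ⊛ series ≋ U p ⊛ U q ⊛ Φ₂ p′ k (X r)
  series-factorization = begin
    U 1 ⊛ U (p * q) ⊛ series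
      ≈⟨ 𝕊.*-congʳ {series} (𝕊.*-congˡ {U 1} (U-^ (p * q))) ⟨
    U 1 ⊛ (X 1 ^ (p * q) ⊕ ⊖ const 1ℤ) ⊛ series
      ≈⟨ factorization p′ k (X 1) Y g (λ {a} {b} {c} → g-below {a} {b} {c}) (λ {a} {b} {c} → g-above {a} {b} {c}) series D
           (≋-trans (𝕊.*-congʳ {D} (𝕊.+-congʳ {⊖ const 1ℤ} (X-^ (p * q))))
             (≋-trans (geometric l (X (p * q))) (𝕊.+-congʳ {⊖ const 1ℤ}
               (≋-trans (≋-sym (X-* (p * q) l)) (𝕊.reflexive (cong X (ℕ.*-comm (p * q) l)))))))
           (≋-trans series-split (𝕊.+-cong coeffT-terms
             (≋-trans (𝕊.reflexive (cong X degree≡)) (X-* r′ (p′ * m))))) ⟩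
    (X 1 ^ p ⊕ ⊖ const 1ℤ) ⊛ (X 1 ^ q ⊕ ⊖ const 1ℤ) ⊛ Φ₂ p′ k (X 1 ⊛ Y)
      ≈⟨ ⊛-cong (⊛-cong (U-^ p) (U-^ q)) (Φ₂-cong p′ k (≋-sym (X-+ 1 r′))) ⟩
    U p ⊛ U q ⊛ Φ₂ p′ k (X r) ∎
    where
    open ≋-Reasoning
    degree≡ : degree ≡ r′ * (p′ * m)
    degree≡ = trans (sym (ℕ.*-assoc p′ m r′)) (ℕ.*-comm (p′ * m) r′)

  gTerms-ascending : ∀ {a b c} → a < p′ → b < k → Ascending (suc (a * q)) (gTerms a b c) (suc a * q)
  gTerms-ascending {a} {b} {c} a<p′ b<k with c ≤? a
  ... | yes _ = Ascending-raise top (weaken bottom (Ascending-run 1ℤ (a * q + b * p + 1) (p′ ∸ a)))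
    where
    open ℕ.≤-Reasoning
    bottom : suc (a * q) ≤ a * q + b * p + 1
    bottom = begin
      suc (a * q)        ≡⟨ ℕ.+-comm 1 (a * q) ⟩
      a * q + 1          ≤⟨ ℕ.+-monoˡ-≤ 1 (ℕ.m≤m+n (a * q) (b * p)) ⟩
      a * q + b * p + 1  ∎
    top : a * q + b * p + 1 + (p′ ∸ a) ≤ suc a * q
    top = begin
      a * q + b * p + 1 + (p′ ∸ a)  ≤⟨ ℕ.+-monoʳ-≤ (a * q + b * p + 1) (ℕ.m∸n≤m p′ a) ⟩
      a * q + b * p + 1 + p′        ≡⟨ below-top a b q p′ ⟩
      a * q + suc b * p             ≤⟨ ℕ.+-monoʳ-≤ (a * q) (ℕ.*-monoˡ-≤ p b<k) ⟩
      a * q + m                     ≤⟨ ℕ.+-monoʳ-≤ (a * q) (ℕ.n≤1+n m) ⟩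
      a * q + q                     ≡⟨ ℕ.+-comm (a * q) q ⟩
      suc a * q                     ∎
  ... | no _ = Ascending-raise top (weaken bottom (Ascending-run -1ℤ (a * m + (b + 1) * p) (a + 1)))
    where
    open ℕ.≤-Reasoning
    bottom : suc (a * q) ≤ a * m + (b + 1) * p
    bottom = begin
      suc (a * q)            ≡⟨ cong suc (ℕ.*-suc a m) ⟩
      suc a + a * m          ≤⟨ ℕ.+-monoˡ-≤ (a * m) (ℕ.m≤n⇒m≤1+n a<p′) ⟩
      p + a * m              ≤⟨ ℕ.+-monoˡ-≤ (a * m) (ℕ.m≤m+n p (b * p)) ⟩
      suc b * p + a * m      ≡⟨ ℕ.+-comm (suc b * p) (a * m) ⟩
      a * m + suc b * p      ≡⟨ cong (λ n → a * m + n * p) (ℕ.+-comm 1 b) ⟩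
      a * m + (b + 1) * p    ∎
    top : a * m + (b + 1) * p + (a + 1) ≤ suc a * q
    top = begin
      a * m + (b + 1) * p + (a + 1)   ≡⟨ cong (λ n → a * m + n * p + (a + 1)) (ℕ.+-comm b 1) ⟩
      a * m + suc b * p + (a + 1)     ≤⟨ ℕ.+-monoˡ-≤ (a + 1) (ℕ.+-monoʳ-≤ (a * m) (ℕ.*-monoˡ-≤ p b<k)) ⟩
      a * m + m + (a + 1)             ≡⟨ above-top a m ⟩
      suc a * q                       ∎

  -- The exponents of `g` lie strictly between `a * q` and `suc a * q`, hence those of `x ^ q * g`
  -- strictly between `suc a * q` and `suc (suc a) * q`. The four groups of monomials are therefore
  -- already in order, and `suc (suc a) ≤ p` gives the upper end.
  fTerms-ascending : ∀ {a b c} → a < p′ → b < k → Ascending 0 (fTerms a b c) (p * q)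
  fTerms-ascending {a} {b} {c} a<p′ b<k = z≤n ∷ Ascending-++
    (weaken (s≤s z≤n) g↑)
    (ℕ.≤-reflexive (cong (_* q) (ℕ.+-comm 1 a))
      ∷ weaken (ℕ.≤-reflexive (trans (cong (λ n → suc (n * q)) (ℕ.+-comm a 1)) (sym (ℕ.+-suc q (a * q)))))
          (Ascending-raise (ℕ.*-monoˡ-≤ q (s≤s a<p′)) (Ascending-shift q (λ _ → refl) g↑)))
    where
    g↑ = gTerms-ascending {a} {b} {c} a<p′ b<k

  next-block : ∀ o i s → o + i * s + s ≡ o + suc i * s
  next-block o i s = trans (ℕ.+-assoc o (i * s) s) (cong (o +_) (ℕ.+-comm (i * s) s))

  -- Each loop fills exactly one step of the enclosing loop: `l` steps of `p * q` make `r′`, `p`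
  -- steps of `r′` make `p * r′`, and `k` steps of `p * r′` make `m * r′`.
  terms-ascending : Ascending 0 (terms k l) degree
  terms-ascending =
    Ascending-blocks 0 (m * r′) p′ _ λ a a<p′ →
      subst (Ascending (a * (m * r′)) _) (end-a a)
        (Ascending-blocks (a * (m * r′)) (p * r′) k _ λ b b<k →
          subst (Ascending (a * (m * r′) + b * (p * r′)) _) (next-block (a * (m * r′)) b (p * r′))
            (Ascending-blocks (a * (m * r′) + b * (p * r′)) r′ p _ λ c _ →
              subst (Ascending (a * (m * r′) + b * (p * r′) + c * r′) _) (next-block (a * (m * r′) + b * (p * r′)) c r′)
                (Ascending-blocks (a * (m * r′) + b * (p * r′) + c * r′) (p * q) l (shiftedTerms a b c) λ d _ →
                  subst₂ (λ lo hi → Ascending lo (shiftedTerms a b c d) hi)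
                    (ℕ.+-identityʳ (dotρ a b c d))
                    (next-block (a * (m * r′) + b * (p * r′) + c * r′) d (p * q))
                    (Ascending-shift (dotρ a b c d) (λ t → ℕ.+-comm (proj₂ t) (dotρ a b c d))
                      (fTerms-ascending {a} {b} {c} a<p′ b<k)))))
    where
    end-a : ∀ a → a * (m * r′) + k * (p * r′) ≡ suc a * (m * r′)
    end-a a = trans (cong (a * (m * r′) +_) (sym (ℕ.*-assoc k p r′))) (ℕ.+-comm (a * (m * r′)) (m * r′))

  Monic-series : Monic degree series
  Monic-series = Monic-cong (≋-sym series-split) (Monic-⊕X (Ascending⇒Bounded terms-ascending))

  series-ascending : Ascending 0 (terms k l ++ [ (1ℤ , degree) ]) (suc degree)
  series-ascending = Ascending-++ terms-ascending (ℕ.≤-refl ∷ [] ℕ.≤-refl)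

  module _ (pp : Prime p) (pq : Prime q) (pr : Prime r) (p<q : p < q) (q<r : q < r) where

    pq≤r′ : p * q ≤ r′
    -- `q<r` gives `1 < r` and so excludes `l = 0`.
    pq≤r′ = ≤-multiple l (ℕ.≤-<-trans (s≤s z≤n) q<r)
      where
      ≤-multiple : ∀ l {n} → 1 < suc (l * n) → n ≤ l * n
      ≤-multiple zero    (s≤s ())
      ≤-multiple (suc l) {n} _ = ℕ.m≤m+n n (l * n)

    allTerms-closed : allTerms ≡ terms k l ++ [ (1ℤ , degree) ]
    allTerms-closed = trans
      (cong₂ (λ n₂ n₄ → terms n₂ n₄ ++ [ (1ℤ , φ (p * q * r)) ])
        (fdiv-suc k p (prime>1 pp)) (fdiv-suc l (p * q) (ℕ.<-trans (prime>1 pp) (ℕ.m<m*n p q (prime>1 pq)))))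
      (cong (λ e → terms k l ++ [ (1ℤ , e) ])
        (trans (φ-pqr pp pq pr p<q (s≤s pq≤r′)) (ℕ.*-assoc p′ m r′)))

    coeff-Φ : coeff (Φ (p * q * r)) ≋ series
    coeff-Φ = fuel 4≤pqr
      where
      -- The longest descending chain of divisors, such as `p * q * r`, `p * q`, `p`, `1`, has four
      -- members, so four units of fuel suffice.
      fuel : ∀ {n} → 4 ≤ n → coeff (cycloF n (p * q * r)) ≋ series
      fuel (s≤s (s≤s (s≤s (s≤s {n = f} _)))) =
        cycloF-pqr {k = k} {l = l} f pp pq pr (ℕ.≤-pred p<q) refl refl pq≤r′ Monic-series series-factorization
      4≤pqr : 4 ≤ p * q * r
      4≤pqr = ℕ.≤-trans (ℕ.*-mono-≤ (prime>1 pp) (prime>1 pq)) (ℕ.m≤m*n (p * q) r)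

    conclusion : ((i : ℕ) → coeff (Φ (p * q * r)) i ≡ coeffT allTerms i)
      × Unique (exponents allTerms) × Linked _<_ (exponents allTerms)
    conclusion rewrite allTerms-closed = coeff-Φ .at , Linked⇒Unique linked , linked
      where linked = Ascending⇒Linked series-ascending

theorem1 : (p₁ p₂ p₃ : ℕ) →
    Prime p₁ → Prime p₂ → Prime p₃ →
    ¬ (2 ∣ p₁) → ¬ (2 ∣ p₂) → ¬ (2 ∣ p₃) →
    p₁ < p₂ → p₂ < p₃ →
    p₁ ∣ (p₂ ∸ 1) → (p₁ * p₂) ∣ (p₃ ∸ 1) →
    let open Construction p₁ p₂ p₃ in
    ((k : ℕ) → coeff (Φ (p₁ * p₂ * p₃)) k ≡ coeffT allTerms k)
    × Unique (exponents allTerms)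
    × Linked _<_ (exponents allTerms)
-- With successors in place `p₂ ∸ 1` and `p₃ ∸ 1` compute, so matching the divisibility witnesses
-- turns `p₂` and `p₃` into `k * p₁ + 1` and `l * (p₁ * p₂) + 1`.
theorem1 (suc p′) (suc _) (suc _) pp pq pr _ _ _ p<q q<r (divides k refl) (divides l refl) =
  conclusion p′ k l pp pq pr p<q q<r
theorem1 zero    _       _    pp _ _ _ _ _ _ _ _ _ with () ← prime>1 pp
theorem1 (suc _) (suc _) zero _ _ _ _ _ _ _ () _ _
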